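{- Let $n$ be an almost-prime number, let $p$ be a prime divisor of $n$, and let $s=s_1s_2\cdots s_r$ be a divisor of $p-1$, where $s_i=q_i^{\nu_i}$ with $q_1,\dots,q_r$ distinct odd primes and $\nu_i\ge1$. Let $g_1,\dots,g_r$ be fixed generators of the groups $(\mathbb{Z}/s_i\mathbb{Z})^{*}$ respectively. For a tuple $L=(l_1,\dots,l_r)$ of integers let $\omega_L$ be the number of distinct prime divisors $p'$ of $n$ with $p'\equiv g_j^{l_j}\pmod{s_j}$ for all $1\le j\le r$. Let $\zeta$ be a primitive $\varphi(s)$-th root of unity, $K=\mathbb{Q}(\zeta)$, and $\mathcal{O}_K=\mathbb{Z}[\zeta]$ its ring of integers. Define $$f(x_1,\dots,x_r)=\prod_{L=(l_1,\dots,l_r)}\left(1+\prod_{i=1}^r x_i^{l_i}\right)^{\omega_L},$$ the product running over all tuples $L$ with $1\le l_i\le\varphi(s_i)$ for each $i$. Then for any $\eta_1,\dots,\eta_r$ such that $\eta_i$ is a $\varphi(s_i)$-th root of unity for each $i$, we have $f(\eta_1,\dots,\eta_r)\equiv d(n)\pmod p$ in $\mathcal{O}_K$, i.e. $f(\eta_1,\dots,\eta_r)-d(n)\in p\mathcal{O}_K$.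
   Context: For a positive integer $n$ with positive divisors $1=d_1<d_2<\dots<d_k=n$, define the polynomial $T_n(x)=x^{d_1}+x^{d_2}+\dots+x^{d_k}-kx$. A positive integer $n$ is called weakly almost-prime if $n\mid T_n(x)$ for all integers $x$; it is called almost-prime if it is weakly almost-prime and square-free. $d(n)$ denotes the number of positive divisors of $n$, and $\varphi$ is Euler's totient function. -}

module Defs where

open import Data.Nat as ℕ using (ℕ; zero; suc; _≤_; _<_; _≤?_; _∸_)
open import Data.Nat.Divisibility as ℕD using (_∣?_)
open import Data.Nat.Coprimality using (Coprime; coprime?)
open import Data.Nat.Primality using (Prime; prime?)
open import Data.Integer as ℤ using (ℤ; +_; 0ℤ; 1ℤ)
open import Data.Integer.Divisibility as ℤD using ()
open import Data.List as List using (List; []; _∷_; length; filter; map; upTo; foldr; reverse; replicate; concatMap; _++_)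
open import Data.Fin as Fin using (Fin)
open import Data.Fin.Properties using (all?)
import Data.Vec.Functional as VF
open import Data.Product using (Σ; ∃; ∃-syntax; _×_; _,_)
open import Relation.Nullary using (Dec; yes; no; ¬_)
open import Relation.Binary.PropositionalEquality using (_≡_; refl)

range1 : ℕ → List ℕ
range1 n = map suc (upTo n)

divisors : ℕ → List ℕ
divisors n = filter (_∣? n) (range1 n)

d : ℕ → ℕ
d n = length (divisors n)

φ : ℕ → ℕ
φ n = length (filter (λ a → coprime? a n) (range1 n))

primeDivisors : ℕ → List ℕ
primeDivisors n = filter (λ q → q ∣? n) (filter prime? (range1 n))

T : ℕ → ℤ → ℤ
T n x = foldr (λ e acc → (x ℤ.^ e) ℤ.+ acc) 0ℤ (divisors n) ℤ.- (+ d n) ℤ.* x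

WeaklyAlmostPrime : ℕ → Set
WeaklyAlmostPrime n = 1 ≤ n × (∀ (x : ℤ) → (+ n) ℤD.∣ T n x)

SquareFree : ℕ → Set
SquareFree n = ∀ m → (m ℕ.* m) ℕD.∣ n → m ≡ 1

AlmostPrime : ℕ → Set
AlmostPrime n = WeaklyAlmostPrime n × SquareFree n

_≡_[mod_] : ℕ → ℕ → ℕ → Set
a ≡ b [mod m ] = (+ m) ℤD.∣ ((+ a) ℤ.- (+ b))

_≡?_[mod_] : ∀ a b m → Dec (a ≡ b [mod m ])
a ≡? b [mod m ] = m ∣? ℤ.∣ (+ a) ℤ.- (+ b) ∣

IsGenerator : ℕ → ℕ → Set
IsGenerator m g = Coprime g m × (∀ a → Coprime a m → ∃[ k ] ((g ℕ.^ k) ≡ a [mod m ]))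

∏ : (r : ℕ) → (Fin r → ℕ) → ℕ
∏ zero    f = 1
∏ (suc r) f = f Fin.zero ℕ.* ∏ r (λ i → f (Fin.suc i))

∑ : (r : ℕ) → (Fin r → ℕ) → ℕ
∑ zero    f = 0
∑ (suc r) f = f Fin.zero ℕ.+ ∑ r (λ i → f (Fin.suc i))

tuples : (r : ℕ) → (Fin r → ℕ) → List (Fin r → ℕ)
tuples zero    b = (λ ()) ∷ []
tuples (suc r) b = concatMap (λ l → map (l VF.∷_) (tuples r (λ i → b (Fin.suc i)))) (range1 (b Fin.zero))

ω : (n r : ℕ) (s g : Fin r → ℕ) (L : Fin r → ℕ) → ℕ
ω n r s g L = length (filter (λ p' → all? (λ j → p' ≡? (g j ℕ.^ L j) [mod s j ])) (primeDivisors n))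

-- Integer polynomials (little-endian coefficient lists) and the ring
-- ℤ[ζ] ≅ ℤ[x]/(Φ_m(x)) for a primitive m-th root of unity ζ.

Poly : Set
Poly = List ℤ

coeff : Poly → ℕ → ℤ
coeff []       _       = 0ℤ
coeff (a ∷ _)  zero    = a
coeff (_ ∷ as) (suc i) = coeff as i

infixl 6 _+ₚ_ _-ₚ_
infixl 7 _*ₚ_

_+ₚ_ : Poly → Poly → Poly
[]       +ₚ q        = q
(a ∷ p)  +ₚ []       = a ∷ p
(a ∷ p)  +ₚ (b ∷ q)  = (a ℤ.+ b) ∷ (p +ₚ q)

scale : ℤ → Poly → Poly
scale c = map (c ℤ.*_)

_-ₚ_ : Poly → Poly → Poly
p -ₚ q = p +ₚ scale (ℤ.- 1ℤ) q

_*ₚ_ : Poly → Poly → Poly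
[]      *ₚ q = []
(a ∷ p) *ₚ q = scale a q +ₚ (0ℤ ∷ (p *ₚ q))

const : ℤ → Poly
const c = c ∷ []

X^ : ℕ → Poly
X^ k = replicate k 0ℤ ++ (1ℤ ∷ [])

_^ₚ_ : Poly → ℕ → Poly
p ^ₚ zero  = const 1ℤ
p ^ₚ suc k = p *ₚ (p ^ₚ k)

∏ₚ : List Poly → Poly
∏ₚ = foldr _*ₚ_ (const 1ℤ)

-- remove leading zeros of a big-endian list
dropZeros : List ℤ → List ℤ
dropZeros []            = []
dropZeros (+ zero ∷ xs) = dropZeros xs
dropZeros (x ∷ xs)      = x ∷ xs

subMul : ℤ → List ℤ → List ℤ → List ℤ
subMul c (x ∷ xs) (y ∷ ys) = (x ℤ.- c ℤ.* y) ∷ subMul c xs ys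
subMul c xs       []       = xs
subMul c []       (_ ∷ _)  = []

-- long division (big-endian) by the monic polynomial 1·x^e + bs,
-- bs = the remaining e big-endian coefficients; returns the quotient
divBE : ℕ → List ℤ → List ℤ → List ℤ
divBE zero    a        bs = []
divBE (suc k) []       bs = []
divBE (suc k) (x ∷ xs) bs with length bs ≤? length xs
... | yes _ = x ∷ divBE k (subMul x xs bs) bs
... | no  _ = []

divMonic : Poly → Poly → Poly
divMonic a b with dropZeros (reverse b)
... | []       = []
... | (_ ∷ bs) = reverse (divBE (length a) (dropZeros (reverse a)) bs)

lookupD : List Poly → ℕ → Poly
lookupD []       _       = []
lookupD (p ∷ _)  zero    = p
lookupD (_ ∷ ps) (suc i) = lookupD ps i

-- cycloList m = [Φ₁, ..., Φ_m], using  x^m - 1 = ∏_{e ∣ m} Φ_e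
cycloList : ℕ → List Poly
cycloList zero    = []
cycloList (suc m) =
  let L = cycloList m in
  L ++ (divMonic (X^ (suc m) -ₚ const 1ℤ)
                 (∏ₚ (map (λ e → lookupD L (e ∸ 1)) (filter (_∣? suc m) (range1 m)))) ∷ [])

Φ : ℕ → Poly
Φ m = lookupD (cycloList m) (m ∸ 1)

-- For P, Q ∈ ℤ[x]:  P(ζ) ≡ Q(ζ) (mod c·ℤ[ζ]) where ζ is a primitive m-th root of unity,
-- i.e.  P - Q ∈ (c, Φ_m) ⊆ ℤ[x]  (using ℤ[ζ] ≅ ℤ[x]/(Φ_m)).
CongZζ : (m : ℕ) (c : ℕ) → Poly → Poly → Set
CongZζ m c P Q = ∃[ A ] ∃[ B ] (∀ i → coeff (P -ₚ Q) i ≡ coeff (scale (+ c) A +ₚ Φ m *ₚ B) i)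

-- The polynomial f(x₁,…,x_r) = ∏_L (1 + ∏ x_i^{l_i})^{ω_L} evaluated at
-- x_i = ζ^{e_i}, as an integer polynomial in ζ.
fAtζ : (n r : ℕ) (s g : Fin r → ℕ) (e : Fin r → ℕ) → Poly
fAtζ n r s g e =
  ∏ₚ (map (λ L → (const 1ℤ +ₚ X^ (∑ r (λ i → L i ℕ.* e i))) ^ₚ ω n r s g L)
          (tuples r (λ i → φ (s i))))

private
  t1 : Φ 1 ≡ (ℤ.- 1ℤ) ∷ 1ℤ ∷ []
  t1 = refl
  t6 : Φ 6 ≡ 1ℤ ∷ (ℤ.- 1ℤ) ∷ 1ℤ ∷ []
  t6 = refl
  t4 : Φ 4 ≡ 1ℤ ∷ 0ℤ ∷ 1ℤ ∷ []
  t4 = refl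
  t12 : Φ 12 ≡ 1ℤ ∷ 0ℤ ∷ (ℤ.- 1ℤ) ∷ 0ℤ ∷ 1ℤ ∷ []
  t12 = refl
  tφ : φ 12 ≡ 4
  tφ = refl
  td : d 12 ≡ 6
  td = refl
  tω : primeDivisors 30 ≡ 2 ∷ 3 ∷ 5 ∷ []
  tω = refl

{-# OPTIONS --safe #-}
module Submission where

-- Let χ(a) = ∏ ηᵢ^{lᵢ} when a ≡ gᵢ^{lᵢ} (mod sᵢ) for all i, and χ(a) = 0 when a is not coprime to s; χ is a
-- multiplicative function of period s, and f(η) = ∏_{p′ ∣ n} (1 + χ(p′)) = Σ_{e ∣ n} χ(e) as n is square-free.
-- By Fermat, T_n agrees on 𝔽_p with the polynomial of degree < p obtained by reducing its exponents modulo
-- p − 1 into 1 … p − 1. That polynomial vanishes on 𝔽_p, so its coefficients are 0 mod p, and the linear map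
-- X^k ↦ χ(k), which does not see the reduction since s ∣ p − 1, gives Σ_{e ∣ n} χ(e) ≡ d(n) χ(1) = d(n).
-- The only fact needed about Φ_m is ζ^m = 1, i.e. that the divisions defining Φ_m are exact; this holds because
-- distinct Φ_e are coprime over ℚ and their product is monic.

open import Defs
open import Level using (0ℓ)
open import Algebra.Bundles using (CommutativeRing)
open import Algebra.Solver.Ring.AlmostCommutativeRing using (fromCommutativeRing; _-Raw-AlmostCommutative⟶_)
import Algebra.Solver.Ring
import Algebra.Properties.CommutativeSemiring.Binomial as Binomial
import Algebra.Properties.Group
import Algebra.Properties.Semiring.Exp
open import Data.Empty using (⊥-elim)
open import Data.Fin as Fin using (Fin; toℕ; fromℕ; inject₁)
open import Data.Fin.Properties as Fin using (all?)
open import Data.Integer as ℤ using (ℤ; +_; 0ℤ; 1ℤ; -[1+_])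
import Data.Integer.Properties as ℤ
open import Data.Integer.Divisibility.Signed as ℤD using (∣ᵤ⇒∣; ∣⇒∣ᵤ) renaming (_∣_ to _∣ℤ_)
open import Data.Integer.Tactic.RingSolver using (solve-∀)
open import Data.List using (List; []; _∷_; _++_; length; reverse; map; filter; upTo; foldr; lookup; concatMap)
import Data.List.Properties as List
open import Data.List.Membership.Propositional using (_∈_)
open import Data.List.Membership.Propositional.Properties using (∈-map⁺; ∈-map⁻; ∈-filter⁺; ∈-filter⁻; ∈-upTo⁺; ∈-upTo⁻; ∈-lookup; ∈-++⁺ˡ; ∈-++⁺ʳ; ∈-++⁻)
open import Data.List.Membership.Propositional.Properties.WithK using (unique∧set⇒bag)
open import Data.List.Relation.Binary.BagAndSetEquality using (∼bag⇒↭)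
open import Data.List.Relation.Binary.Permutation.Propositional as Perm using (_↭_)
open import Data.List.Relation.Unary.All as All using (All; []; _∷_)
import Data.List.Relation.Unary.All.Properties as All
open import Data.List.Relation.Unary.AllPairs as AllPairs using (AllPairs; []; _∷_)
import Data.List.Relation.Unary.AllPairs.Properties as AllPairs
open import Data.List.Relation.Unary.Any as Any using (here; there)
import Data.List.Relation.Unary.Any.Properties as Any
open import Data.List.Relation.Unary.Unique.Propositional using (Unique)
import Data.List.Relation.Unary.Unique.Propositional.Properties as Unique
open import Data.Maybe using (Maybe; just; nothing)
open import Data.Nat as ℕ using (ℕ; zero; suc; _≤_; _<_; _≤?_; s≤s; z≤n; s≤s⁻¹; _∸_; NonZero; >-nonZero; ≢-nonZero; _!)
import Data.Nat.Properties as ℕP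
open import Data.Nat.Combinatorics using (nCn≡1; nCk≡n!/k![n-k]!; k![n∸k]!∣n!) renaming (_C_ to _choose_)
open import Data.Nat.Coprimality as Coprimality using (Coprime; coprime?; coprime-divisor)
open import Data.Nat.Divisibility as ℕD using (_∣_; _∣?_)
open import Data.Nat.DivMod using (_%_; _/_; m%n<n; m≡m%n+[m/n]*n; m/n*n≡m)
open import Data.Nat.GCD using (module Bézout; gcd; gcd[m,n]∣m; gcd[m,n]∣n; gcd-GCD; gcd[m,n]≢0)
open import Data.Nat.Induction using (<-rec)
open import Data.Nat.ListAction using (product)
open import Data.Nat.ListAction.Properties using (∈⇒∣product)
open import Data.Nat.Primality using (Prime; prime?; euclidsLemma; ¬prime[1]; prime⇒nonTrivial; prime⇒nonZero; prime⇒irreducible)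
open import Data.Nat.Primality.Factorisation using (factorise; factorisationHasAllPrimeFactors)
open import Data.Product using (∃-syntax; _×_; _,_; proj₁; proj₂)
open import Data.Sum as Sum using (_⊎_; inj₁; inj₂)
import Data.Vec.Functional as VF
open import Function using (_on_; _∘_; _$_; mk⇔)
open import Relation.Binary.Definitions using (tri<; tri≈; tri>)
open import Relation.Binary.PropositionalEquality as ≡ using (_≡_; _≢_; refl; cong; cong₂; module ≡-Reasoning)
import Relation.Binary.Reasoning.Setoid
open import Relation.Nullary using (Dec; yes; no; ¬_)

-- The ring ℤ[X] of coefficient lists

-- `Φ` is defined by running a long division, so nothing is known about it until that division is
-- shown to leave no remainder. The coprimality needed for this is itself derived from the
-- factorisation of X^e - 1 at smaller indices, so factorisation and coprimality go through one
-- strong induction. Irreducibility of Φ_m is avoided. The claim is an equation in ℤ[X]/(p, Φ_m),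
-- and χ takes its values there. As this ring can have zero divisors, roots are counted over ℤ
-- modulo p, and only the resulting divisibility of coefficients is carried into the ring. ℚ is
-- avoided by clearing denominators: coprimality means that a nonzero integer lies in the ideal (P,
-- Q) of ℤ[X], and this integer is removed again by comparing degrees with a monic divisor. A
-- generator is given only by the fact that its powers reach every unit. That its exponents are
-- determined modulo φ(sᵢ), without which χ would be ill defined, comes from counting.

infix 4 _≈ₚ_

-- Lists that differ by trailing zeros represent the same polynomial, so equality is taken on
-- coefficients. The record wrapper lets unification recover `P` and `Q`.
record _≈ₚ_ (P Q : Poly) : Set where
  constructor coeffwise
  field at : ∀ i → coeff P i ≡ coeff Q i

open _≈ₚ_

≈ₚ-refl : ∀ {P} → P ≈ₚ P
≈ₚ-refl = coeffwise λ _ → refl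

≈ₚ-sym : ∀ {P Q} → P ≈ₚ Q → Q ≈ₚ P
≈ₚ-sym e = coeffwise λ i → ≡.sym (at e i)

≈ₚ-trans : ∀ {P Q R} → P ≈ₚ Q → Q ≈ₚ R → P ≈ₚ R
≈ₚ-trans e f = coeffwise λ i → ≡.trans (at e i) (at f i)

coeff-+ₚ : ∀ P Q i → coeff (P +ₚ Q) i ≡ coeff P i ℤ.+ coeff Q i
coeff-+ₚ []      Q       i       = ≡.sym (ℤ.+-identityˡ _)
coeff-+ₚ (a ∷ P) []      i       = ≡.sym (ℤ.+-identityʳ _)
coeff-+ₚ (a ∷ P) (b ∷ Q) zero    = refl
coeff-+ₚ (a ∷ P) (b ∷ Q) (suc i) = coeff-+ₚ P Q i

coeff-scale : ∀ c P i → coeff (scale c P) i ≡ c ℤ.* coeff P i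
coeff-scale c []      i       = ≡.sym (ℤ.*-zeroʳ c)
coeff-scale c (a ∷ P) zero    = refl
coeff-scale c (a ∷ P) (suc i) = coeff-scale c P i

coeff--ₚ : ∀ P Q i → coeff (P -ₚ Q) i ≡ coeff P i ℤ.- coeff Q i
coeff--ₚ P Q i = ≡.trans (coeff-+ₚ P _ i) (cong (ℤ._+_ (coeff P i)) (≡.trans (coeff-scale (ℤ.- 1ℤ) Q i) (ℤ.-1*i≡-i (coeff Q i))))

+ₚ-cong : ∀ {P P′ Q Q′} → P ≈ₚ P′ → Q ≈ₚ Q′ → P +ₚ Q ≈ₚ P′ +ₚ Q′
+ₚ-cong {P} {P′} {Q} {Q′} e f = coeffwise λ i → begin
  coeff (P +ₚ Q) i          ≡⟨ coeff-+ₚ P Q i ⟩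
  coeff P i ℤ.+ coeff Q i   ≡⟨ cong₂ ℤ._+_ (at e i) (at f i) ⟩
  coeff P′ i ℤ.+ coeff Q′ i ≡⟨ coeff-+ₚ P′ Q′ i ⟨
  coeff (P′ +ₚ Q′) i        ∎ where open ≡-Reasoning

scale-cong : ∀ c {P Q} → P ≈ₚ Q → scale c P ≈ₚ scale c Q
scale-cong c {P} {Q} e = coeffwise λ i →
  ≡.trans (coeff-scale c P i) (≡.trans (cong (c ℤ.*_) (at e i)) (≡.sym (coeff-scale c Q i)))

∷-cong : ∀ {a b P Q} → a ≡ b → P ≈ₚ Q → a ∷ P ≈ₚ b ∷ Q
∷-cong a≡b e = coeffwise λ { zero → a≡b ; (suc i) → at e i }

+ₚ-assoc : ∀ P Q R → (P +ₚ Q) +ₚ R ≈ₚ P +ₚ (Q +ₚ R)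
+ₚ-assoc P Q R = coeffwise λ i → begin
  coeff ((P +ₚ Q) +ₚ R) i                  ≡⟨ coeff-+ₚ (P +ₚ Q) R i ⟩
  coeff (P +ₚ Q) i ℤ.+ coeff R i           ≡⟨ cong (ℤ._+ coeff R i) (coeff-+ₚ P Q i) ⟩
  coeff P i ℤ.+ coeff Q i ℤ.+ coeff R i    ≡⟨ ℤ.+-assoc (coeff P i) _ _ ⟩
  coeff P i ℤ.+ (coeff Q i ℤ.+ coeff R i)  ≡⟨ cong (ℤ._+_ (coeff P i)) (coeff-+ₚ Q R i) ⟨
  coeff P i ℤ.+ coeff (Q +ₚ R) i           ≡⟨ coeff-+ₚ P (Q +ₚ R) i ⟨
  coeff (P +ₚ (Q +ₚ R)) i                  ∎ where open ≡-Reasoning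

+ₚ-comm : ∀ P Q → P +ₚ Q ≈ₚ Q +ₚ P
+ₚ-comm P Q = coeffwise λ i →
  ≡.trans (coeff-+ₚ P Q i) (≡.trans (ℤ.+-comm (coeff P i) _) (≡.sym (coeff-+ₚ Q P i)))

+ₚ-identityʳ : ∀ P → P +ₚ [] ≈ₚ P
+ₚ-identityʳ P = +ₚ-comm P []

+ₚ-inverseʳ : ∀ P → P -ₚ P ≈ₚ []
+ₚ-inverseʳ P = coeffwise λ i → ≡.trans (coeff--ₚ P P i) (ℤ.+-inverseʳ (coeff P i))

0∷[]≈[] : 0ℤ ∷ [] ≈ₚ []
0∷[]≈[] = coeffwise λ { zero → refl ; (suc i) → refl }

*ₚ-congˡ : ∀ P {Q Q′} → Q ≈ₚ Q′ → P *ₚ Q ≈ₚ P *ₚ Q′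
*ₚ-congˡ []      e = ≈ₚ-refl
*ₚ-congˡ (a ∷ P) e = +ₚ-cong (scale-cong a e) (∷-cong refl (*ₚ-congˡ P e))

*ₚ-zeroʳ : ∀ P → P *ₚ [] ≈ₚ []
*ₚ-zeroʳ []      = ≈ₚ-refl
*ₚ-zeroʳ (a ∷ P) = ≈ₚ-trans (∷-cong refl (*ₚ-zeroʳ P)) 0∷[]≈[]

coeff-∷-*ₚ : ∀ a P Q i → coeff ((a ∷ P) *ₚ Q) i ≡ a ℤ.* coeff Q i ℤ.+ coeff (0ℤ ∷ (P *ₚ Q)) i
coeff-∷-*ₚ a P Q i = ≡.trans (coeff-+ₚ (scale a Q) _ i) (cong (ℤ._+ _) (coeff-scale a Q i))

-- `_*ₚ_` recurses on its left factor; this mirrored recursion on the right factor is what the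
-- induction for `*ₚ-comm` needs.
*ₚ-∷ʳ : ∀ P b Q → P *ₚ (b ∷ Q) ≈ₚ scale b P +ₚ (0ℤ ∷ (P *ₚ Q))
*ₚ-∷ʳ []      b Q = ≈ₚ-sym 0∷[]≈[]
*ₚ-∷ʳ (a ∷ P) b Q = coeffwise λ
  { zero    → cong (ℤ._+ 0ℤ) (ℤ.*-comm a b)
  ; (suc i) → begin
      coeff (scale a Q +ₚ P *ₚ (b ∷ Q)) i
        ≡⟨ coeff-+ₚ (scale a Q) _ i ⟩
      coeff (scale a Q) i ℤ.+ coeff (P *ₚ (b ∷ Q)) i
        ≡⟨ cong₂ ℤ._+_ (coeff-scale a Q i) (≡.trans (at (*ₚ-∷ʳ P b Q) i) (coeff-+ₚ (scale b P) _ i)) ⟩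
      a ℤ.* coeff Q i ℤ.+ (coeff (scale b P) i ℤ.+ coeff (0ℤ ∷ (P *ₚ Q)) i)
        ≡⟨ exchange (a ℤ.* coeff Q i) (coeff (scale b P) i) _ ⟩
      coeff (scale b P) i ℤ.+ (a ℤ.* coeff Q i ℤ.+ coeff (0ℤ ∷ (P *ₚ Q)) i)
        ≡⟨ cong (ℤ._+_ (coeff (scale b P) i)) (coeff-∷-*ₚ a P Q i) ⟨
      coeff (scale b P) i ℤ.+ coeff ((a ∷ P) *ₚ Q) i
        ≡⟨ coeff-+ₚ (scale b P) _ i ⟨
      coeff (scale b P +ₚ (a ∷ P) *ₚ Q) i ∎ }
  where
  open ≡-Reasoning
  exchange : ∀ x y z → x ℤ.+ (y ℤ.+ z) ≡ y ℤ.+ (x ℤ.+ z)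
  exchange = solve-∀

*ₚ-comm : ∀ P Q → P *ₚ Q ≈ₚ Q *ₚ P
*ₚ-comm []      Q = ≈ₚ-sym (*ₚ-zeroʳ Q)
*ₚ-comm (a ∷ P) Q =
  ≈ₚ-trans (+ₚ-cong ≈ₚ-refl (∷-cong refl (*ₚ-comm P Q))) (≈ₚ-sym (*ₚ-∷ʳ Q a P))

*ₚ-cong : ∀ {P P′ Q Q′} → P ≈ₚ P′ → Q ≈ₚ Q′ → P *ₚ Q ≈ₚ P′ *ₚ Q′
*ₚ-cong {P} {P′} {Q} {Q′} e f =
  ≈ₚ-trans (*ₚ-congˡ P f) (≈ₚ-trans (*ₚ-comm P Q′) (≈ₚ-trans (*ₚ-congˡ Q′ e) (*ₚ-comm Q′ P′)))

*ₚ-distribˡ-+ₚ : ∀ P Q R → P *ₚ (Q +ₚ R) ≈ₚ P *ₚ Q +ₚ P *ₚ R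
*ₚ-distribˡ-+ₚ []      Q R = ≈ₚ-refl
*ₚ-distribˡ-+ₚ (a ∷ P) Q R = coeffwise λ i → begin
  coeff ((a ∷ P) *ₚ (Q +ₚ R)) i
    ≡⟨ coeff-∷-*ₚ a P (Q +ₚ R) i ⟩
  a ℤ.* coeff (Q +ₚ R) i ℤ.+ coeff (0ℤ ∷ (P *ₚ (Q +ₚ R))) i
    ≡⟨ cong₂ (λ x y → a ℤ.* x ℤ.+ y) (coeff-+ₚ Q R i) (split i) ⟩
  a ℤ.* (coeff Q i ℤ.+ coeff R i) ℤ.+ (coeff (0ℤ ∷ (P *ₚ Q)) i ℤ.+ coeff (0ℤ ∷ (P *ₚ R)) i)
    ≡⟨ rearrange a (coeff Q i) (coeff R i) _ _ ⟩
  (a ℤ.* coeff Q i ℤ.+ coeff (0ℤ ∷ (P *ₚ Q)) i) ℤ.+ (a ℤ.* coeff R i ℤ.+ coeff (0ℤ ∷ (P *ₚ R)) i)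
    ≡⟨ cong₂ ℤ._+_ (coeff-∷-*ₚ a P Q i) (coeff-∷-*ₚ a P R i) ⟨
  coeff ((a ∷ P) *ₚ Q) i ℤ.+ coeff ((a ∷ P) *ₚ R) i
    ≡⟨ coeff-+ₚ ((a ∷ P) *ₚ Q) _ i ⟨
  coeff ((a ∷ P) *ₚ Q +ₚ (a ∷ P) *ₚ R) i ∎
  where
  open ≡-Reasoning
  split : ∀ i → coeff (0ℤ ∷ (P *ₚ (Q +ₚ R))) i
              ≡ coeff (0ℤ ∷ (P *ₚ Q)) i ℤ.+ coeff (0ℤ ∷ (P *ₚ R)) i
  split zero    = refl
  split (suc i) = ≡.trans (at (*ₚ-distribˡ-+ₚ P Q R) i) (coeff-+ₚ (P *ₚ Q) _ i)
  rearrange : ∀ a x y u v → a ℤ.* (x ℤ.+ y) ℤ.+ (u ℤ.+ v) ≡ (a ℤ.* x ℤ.+ u) ℤ.+ (a ℤ.* y ℤ.+ v)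
  rearrange = solve-∀

*ₚ-distribʳ-+ₚ : ∀ P Q R → (Q +ₚ R) *ₚ P ≈ₚ Q *ₚ P +ₚ R *ₚ P
*ₚ-distribʳ-+ₚ P Q R = ≈ₚ-trans (*ₚ-comm (Q +ₚ R) P)
  (≈ₚ-trans (*ₚ-distribˡ-+ₚ P Q R) (+ₚ-cong (*ₚ-comm P Q) (*ₚ-comm P R)))

scale-*ₚ : ∀ c P Q → scale c P *ₚ Q ≈ₚ scale c (P *ₚ Q)
scale-*ₚ c []      Q = ≈ₚ-refl
scale-*ₚ c (a ∷ P) Q = coeffwise λ i → begin
  coeff ((c ℤ.* a ∷ scale c P) *ₚ Q) i
    ≡⟨ coeff-∷-*ₚ (c ℤ.* a) (scale c P) Q i ⟩
  c ℤ.* a ℤ.* coeff Q i ℤ.+ coeff (0ℤ ∷ (scale c P *ₚ Q)) i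
    ≡⟨ cong (ℤ._+_ (c ℤ.* a ℤ.* coeff Q i)) (split i) ⟩
  c ℤ.* a ℤ.* coeff Q i ℤ.+ c ℤ.* coeff (0ℤ ∷ (P *ₚ Q)) i
    ≡⟨ rearrange c a (coeff Q i) _ ⟩
  c ℤ.* (a ℤ.* coeff Q i ℤ.+ coeff (0ℤ ∷ (P *ₚ Q)) i)
    ≡⟨ cong (c ℤ.*_) (coeff-∷-*ₚ a P Q i) ⟨
  c ℤ.* coeff ((a ∷ P) *ₚ Q) i
    ≡⟨ coeff-scale c ((a ∷ P) *ₚ Q) i ⟨
  coeff (scale c ((a ∷ P) *ₚ Q)) i ∎
  where
  open ≡-Reasoning
  split : ∀ i → coeff (0ℤ ∷ (scale c P *ₚ Q)) i ≡ c ℤ.* coeff (0ℤ ∷ (P *ₚ Q)) i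
  split zero    = ≡.sym (ℤ.*-zeroʳ c)
  split (suc i) = ≡.trans (at (scale-*ₚ c P Q) i) (coeff-scale c (P *ₚ Q) i)
  rearrange : ∀ c a x u → c ℤ.* a ℤ.* x ℤ.+ c ℤ.* u ≡ c ℤ.* (a ℤ.* x ℤ.+ u)
  rearrange = solve-∀

0∷-*ₚ : ∀ P Q → (0ℤ ∷ P) *ₚ Q ≈ₚ 0ℤ ∷ (P *ₚ Q)
0∷-*ₚ P Q = coeffwise λ i → ≡.trans (coeff-∷-*ₚ 0ℤ P Q i) (ℤ.+-identityˡ _)

*ₚ-assoc : ∀ P Q R → (P *ₚ Q) *ₚ R ≈ₚ P *ₚ (Q *ₚ R)
*ₚ-assoc []      Q R = ≈ₚ-refl
*ₚ-assoc (a ∷ P) Q R =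
  ≈ₚ-trans (*ₚ-distribʳ-+ₚ R (scale a Q) (0ℤ ∷ (P *ₚ Q)))
  (+ₚ-cong (scale-*ₚ a Q R)
           (≈ₚ-trans (0∷-*ₚ (P *ₚ Q) R) (∷-cong refl (*ₚ-assoc P Q R))))

const-*ₚ : ∀ c P → const c *ₚ P ≈ₚ scale c P
const-*ₚ c P = ≈ₚ-trans (+ₚ-cong (≈ₚ-refl {scale c P}) 0∷[]≈[]) (+ₚ-identityʳ (scale c P))

*ₚ-identityˡ : ∀ P → const 1ℤ *ₚ P ≈ₚ P
*ₚ-identityˡ P = ≈ₚ-trans (const-*ₚ 1ℤ P)
  (coeffwise λ i → ≡.trans (coeff-scale 1ℤ P i) (ℤ.*-identityˡ _))

polyRing : CommutativeRing 0ℓ 0ℓ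
polyRing = record
  { Carrier = Poly ; _≈_ = _≈ₚ_ ; _+_ = _+ₚ_ ; _*_ = _*ₚ_
  ; -_ = scale (ℤ.- 1ℤ) ; 0# = [] ; 1# = const 1ℤ
  ; isCommutativeRing = record
    { isRing = record
      { +-isAbelianGroup = record
        { isGroup = record
          { isMonoid = record
            { isSemigroup = record
              { isMagma = record
                { isEquivalence = record { refl = ≈ₚ-refl ; sym = ≈ₚ-sym ; trans = ≈ₚ-trans }
                ; ∙-cong = +ₚ-cong }
              ; assoc = +ₚ-assoc }
            ; identity = (λ _ → ≈ₚ-refl) , +ₚ-identityʳ }
          ; inverse = (λ P → ≈ₚ-trans (+ₚ-comm (scale (ℤ.- 1ℤ) P) P) (+ₚ-inverseʳ P)) , +ₚ-inverseʳ
          ; ⁻¹-cong = scale-cong (ℤ.- 1ℤ) }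
        ; comm = +ₚ-comm }
      ; *-cong = *ₚ-cong
      ; *-assoc = *ₚ-assoc
      ; *-identity = *ₚ-identityˡ , λ P → ≈ₚ-trans (*ₚ-comm P _) (*ₚ-identityˡ P)
      ; distrib = *ₚ-distribˡ-+ₚ , *ₚ-distribʳ-+ₚ }
    ; *-comm = *ₚ-comm } }

-- ℤ-algebras and quotients by ideals with two generators

-- The same arguments are run in ℤ[X], ℤ/m, ℤ[X]/(Φ_m, Φ_f) and ℤ[X]/(p, Φ_m), hence the
-- abstraction. The map from ℤ also supplies the coefficients of the ring solver.
record ℤ-Algebra : Set₁ where
  field
    commutativeRing : CommutativeRing 0ℓ 0ℓ
    fromℤ           : ℤ.+-*-rawRing -Raw-AlmostCommutative⟶ fromCommutativeRing commutativeRing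

module AlgebraTheory (𝓐 : ℤ-Algebra) where
  open ℤ-Algebra 𝓐 public
  open CommutativeRing commutativeRing public
    renaming (refl to ≈-refl; sym to ≈-sym; trans to ≈-trans; zero to *-zero)
  open _-Raw-AlmostCommutative⟶_ fromℤ public
    renaming (⟦_⟧ to ι; +-homo to ι-+; *-homo to ι-*; -‿homo to ι-neg; 0-homo to ι-0; 1-homo to ι-1)
  open Algebra.Properties.Semiring.Exp semiring public
  open Algebra.Properties.Group +-group public using () renaming (x∙y⁻¹≈ε⇒x≈y to x-y≈0⇒x≈y)
  open Relation.Binary.Reasoning.Setoid setoid public

  private
    ι-≟ : ∀ m n → Maybe (ι m ≈ ι n)
    ι-≟ m n with m ℤ.≟ n
    ... | yes refl = just ≈-refl
    ... | no _     = nothing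

  open Algebra.Solver.Ring ℤ.+-*-rawRing (fromCommutativeRing commutativeRing) fromℤ ι-≟ public
    using (solve; _:=_; _:+_; _:*_; _:-_; :-_; con)

  1^n≈1 : ∀ n → 1# ^ n ≈ 1#
  1^n≈1 zero    = ≈-refl
  1^n≈1 (suc n) = ≈-trans (*-identityˡ _) (1^n≈1 n)

  x-1≈0⇒x≈1 : ∀ {x} → x - 1# ≈ 0# → x ≈ 1#
  x-1≈0⇒x≈1 = x-y≈0⇒x≈y _ _

  x≈y⇒x-y≈0 : ∀ {x y} → x ≈ y → x - y ≈ 0#
  x≈y⇒x-y≈0 {x} {y} e = ≈-trans (+-congʳ e) (-‿inverseʳ y)

  ^-drop-period : ∀ {x m} → x ^ m ≈ 1# → ∀ k u → x ^ (k ℕ.+ u ℕ.* m) ≈ x ^ k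
  ^-drop-period {x} {m} xᵐ≈1 k u = begin
    x ^ (k ℕ.+ u ℕ.* m)      ≈⟨ ^-homo-* x k (u ℕ.* m) ⟩
    x ^ k * x ^ (u ℕ.* m)    ≡⟨ cong (λ t → x ^ k * x ^ t) (ℕP.*-comm u m) ⟩
    x ^ k * x ^ (m ℕ.* u)    ≈⟨ *-congˡ (^-assocʳ x m u) ⟨
    x ^ k * (x ^ m) ^ u      ≈⟨ *-congˡ (^-congˡ u xᵐ≈1) ⟩
    x ^ k * 1# ^ u           ≈⟨ *-congˡ (1^n≈1 u) ⟩
    x ^ k * 1#               ≈⟨ *-identityʳ _ ⟩
    x ^ k                    ∎

  -- Bézout over ℕ reads d + v·n = u·m, so the exponent d is padded with periods and `x` need not be
  -- inverted.
  ^-gcd : ∀ {x m n d} → Bézout.Identity d m n → x ^ m ≈ 1# → x ^ n ≈ 1# → x ^ d ≈ 1#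
  ^-gcd {x} {d = d} (Bézout.+- u v eq) xᵐ≈1 xⁿ≈1 = begin
    x ^ d                ≈⟨ ^-drop-period xⁿ≈1 d v ⟨
    x ^ (d ℕ.+ v ℕ.* _)  ≡⟨ cong (x ^_) eq ⟩
    x ^ (u ℕ.* _)        ≈⟨ ^-drop-period xᵐ≈1 0 u ⟩
    1#                   ∎
  ^-gcd (Bézout.-+ u v eq) xᵐ≈1 xⁿ≈1 = ^-gcd (Bézout.+- v u eq) xⁿ≈1 xᵐ≈1

  -- Horner form of 1 + t + ... + t^(k-1).
  geometric : ℕ → Carrier → Carrier
  geometric zero    t = 0#
  geometric (suc k) t = 1# + t * geometric k t

  geometric-sum : ∀ k t → geometric k t * (t - 1#) ≈ t ^ k - 1#
  geometric-sum zero    t = ≈-trans (zeroˡ _) (≈-sym (-‿inverseʳ 1#))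
  geometric-sum (suc k) t = begin
    (1# + t * geometric k t) * (t - 1#)
      ≈⟨ solve 3 (λ t g o → (o :+ t :* g) :* (t :- o) := o :* (t :- o) :+ t :* (g :* (t :- o))) ≈-refl t (geometric k t) 1# ⟩
    1# * (t - 1#) + t * (geometric k t * (t - 1#))
      ≈⟨ +-cong (*-identityˡ _) (*-congˡ (geometric-sum k t)) ⟩
    (t - 1#) + t * (t ^ k - 1#)
      -- The solver sees `1#` as the opaque variable `o`, which leaves `t - t * 1#` to be cancelled
      -- by hand.
      ≈⟨ solve 3 (λ t g o → (t :- o) :+ t :* (g :- o) := t :* g :- o :+ (t :- t :* o)) ≈-refl t (t ^ k) 1# ⟩
    t * t ^ k - 1# + (t - t * 1#)
      ≈⟨ +-congˡ (x≈y⇒x-y≈0 (≈-sym (*-identityʳ t))) ⟩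
    t * t ^ k - 1# + 0#
      ≈⟨ +-identityʳ _ ⟩
    t * t ^ k - 1# ∎

  geometric-at-1 : ∀ k {t} → t ≈ 1# → geometric k t ≈ ι (+ k)
  geometric-at-1 zero    e = ≈-sym ι-0
  geometric-at-1 (suc k) {t} e = begin
    1# + t * geometric k t ≈⟨ +-cong (≈-sym ι-1) (≈-trans (*-cong e (geometric-at-1 k e)) (*-identityˡ _)) ⟩
    ι 1ℤ + ι (+ k)         ≈⟨ ι-+ 1ℤ (+ k) ⟨
    ι (+ suc k)            ∎

module Quotient (𝓐 : ℤ-Algebra) (a b : CommutativeRing.Carrier (ℤ-Algebra.commutativeRing 𝓐)) where
  open AlgebraTheory 𝓐

  infix 4 _~_
  -- Two generators serve both (p, Φ_m) and (Φ_m, Φ_f); ℤ/m takes 0 as the second one. The cofactors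
  -- are kept as data because `CongZζ` and `CoprimeOverℚ` ask for them.
  record _~_ (x y : Carrier) : Set where
    constructor modulo
    field
      cofactor₁ cofactor₂ : Carrier
      difference          : x - y ≈ a * cofactor₁ + b * cofactor₂

  ≈⇒~ : ∀ {x y} → x ≈ y → x ~ y
  ≈⇒~ {x} {y} e = modulo 0# 0# (begin
    x - y           ≈⟨ x≈y⇒x-y≈0 e ⟩
    0#              ≈⟨ ≈-trans (+-cong (zeroʳ a) (zeroʳ b)) (+-identityˡ 0#) ⟨
    a * 0# + b * 0# ∎)

  generator₁~0 : ∀ x → a * x ~ 0#
  generator₁~0 x = modulo x 0# (begin
    a * x - 0#     ≈⟨ +-cong ≈-refl (≈-trans (≈-sym (+-identityˡ _)) (-‿inverseʳ 0#)) ⟩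
    a * x + 0#     ≈⟨ +-congˡ (zeroʳ b) ⟨
    a * x + b * 0# ∎)

  generator₂~0 : ∀ x → b * x ~ 0#
  generator₂~0 x = modulo 0# x (begin
    b * x - 0#     ≈⟨ +-cong ≈-refl (≈-trans (≈-sym (+-identityˡ _)) (-‿inverseʳ 0#)) ⟩
    b * x + 0#     ≈⟨ +-comm _ _ ⟩
    0# + b * x     ≈⟨ +-congʳ (zeroʳ a) ⟨
    a * 0# + b * x ∎)

  ~-sym : ∀ {x y} → x ~ y → y ~ x
  ~-sym {x} {y} (modulo A B e) = modulo (- A) (- B) (begin
    y - x               ≈⟨ solve 2 (λ x y → y :- x := :- (x :- y)) ≈-refl x y ⟩
    - (x - y)           ≈⟨ -‿cong e ⟩
    - (a * A + b * B)   ≈⟨ solve 4 (λ a b A B → :- (a :* A :+ b :* B) := a :* (:- A) :+ b :* (:- B)) ≈-refl a b A B ⟩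
    a * - A + b * - B   ∎)

  ~-trans : ∀ {x y z} → x ~ y → y ~ z → x ~ z
  ~-trans {x} {y} {z} (modulo A B e) (modulo A′ B′ e′) = modulo (A + A′) (B + B′) (begin
    x - z                                ≈⟨ solve 3 (λ x y z → x :- z := (x :- y) :+ (y :- z)) ≈-refl x y z ⟩
    (x - y) + (y - z)                    ≈⟨ +-cong e e′ ⟩
    (a * A + b * B) + (a * A′ + b * B′)  ≈⟨ solve 6 (λ a b A B A′ B′ → (a :* A :+ b :* B) :+ (a :* A′ :+ b :* B′)
                                                       := a :* (A :+ A′) :+ b :* (B :+ B′)) ≈-refl a b A B A′ B′ ⟩
    a * (A + A′) + b * (B + B′)          ∎)

  ~-+-cong : ∀ {x y u v} → x ~ y → u ~ v → x + u ~ y + v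
  ~-+-cong {x} {y} {u} {v} (modulo A B e) (modulo A′ B′ e′) = modulo (A + A′) (B + B′) (begin
    (x + u) - (y + v)                    ≈⟨ solve 4 (λ x y u v → (x :+ u) :- (y :+ v) := (x :- y) :+ (u :- v)) ≈-refl x y u v ⟩
    (x - y) + (u - v)                    ≈⟨ +-cong e e′ ⟩
    (a * A + b * B) + (a * A′ + b * B′)  ≈⟨ solve 6 (λ a b A B A′ B′ → (a :* A :+ b :* B) :+ (a :* A′ :+ b :* B′)
                                                       := a :* (A :+ A′) :+ b :* (B :+ B′)) ≈-refl a b A B A′ B′ ⟩
    a * (A + A′) + b * (B + B′)          ∎)

  ~-*-congˡ : ∀ u {x y} → x ~ y → x * u ~ y * u
  ~-*-congˡ u {x} {y} (modulo A B e) = modulo (A * u) (B * u) (begin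
    x * u - y * u               ≈⟨ solve 3 (λ x y u → x :* u :- y :* u := (x :- y) :* u) ≈-refl x y u ⟩
    (x - y) * u                 ≈⟨ *-congʳ e ⟩
    (a * A + b * B) * u         ≈⟨ solve 5 (λ a b A B u → (a :* A :+ b :* B) :* u
                                             := a :* (A :* u) :+ b :* (B :* u)) ≈-refl a b A B u ⟩
    a * (A * u) + b * (B * u)   ∎)

  ~-*-cong : ∀ {x y u v} → x ~ y → u ~ v → x * u ~ y * v
  ~-*-cong {x} {y} {u} {v} e f =
    ~-trans (~-*-congˡ u e) (~-trans (≈⇒~ (*-comm y u)) (~-trans (~-*-congˡ y f) (≈⇒~ (*-comm v y))))

  ~-neg-cong : ∀ {x y} → x ~ y → - x ~ - y
  ~-neg-cong {x} {y} (modulo A B e) = modulo (- A) (- B) (begin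
    - x - - y           ≈⟨ solve 2 (λ x y → :- x :- :- y := :- (x :- y)) ≈-refl x y ⟩
    - (x - y)           ≈⟨ -‿cong e ⟩
    - (a * A + b * B)   ≈⟨ solve 4 (λ a b A B → :- (a :* A :+ b :* B) := a :* (:- A) :+ b :* (:- B)) ≈-refl a b A B ⟩
    a * - A + b * - B   ∎)

  quotient : ℤ-Algebra
  quotient = record
    { commutativeRing = record
      { Carrier = Carrier ; _≈_ = _~_ ; _+_ = _+_ ; _*_ = _*_ ; -_ = -_ ; 0# = 0# ; 1# = 1#
      ; isCommutativeRing = record
        { isRing = record
          { +-isAbelianGroup = record
            { isGroup = record
              { isMonoid = record
                { isSemigroup = record
                  { isMagma = record
                    { isEquivalence = record { refl = ≈⇒~ ≈-refl ; sym = ~-sym ; trans = ~-trans }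
                    ; ∙-cong = ~-+-cong }
                  ; assoc = λ x y z → ≈⇒~ (+-assoc x y z) }
                ; identity = (λ x → ≈⇒~ (+-identityˡ x)) , λ x → ≈⇒~ (+-identityʳ x) }
              ; inverse = (λ x → ≈⇒~ (-‿inverseˡ x)) , λ x → ≈⇒~ (-‿inverseʳ x)
              ; ⁻¹-cong = ~-neg-cong }
            ; comm = λ x y → ≈⇒~ (+-comm x y) }
          ; *-cong = ~-*-cong
          ; *-assoc = λ x y z → ≈⇒~ (*-assoc x y z)
          ; *-identity = (λ x → ≈⇒~ (*-identityˡ x)) , λ x → ≈⇒~ (*-identityʳ x)
          ; distrib = (λ x y z → ≈⇒~ (distribˡ x y z)) , λ x y z → ≈⇒~ (distribʳ x y z) }
        ; *-comm = λ x y → ≈⇒~ (*-comm x y) } }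
    ; fromℤ = record
      { ⟦_⟧ = ι ; +-homo = λ m n → ≈⇒~ (ι-+ m n) ; *-homo = λ m n → ≈⇒~ (ι-* m n)
      ; -‿homo = λ m → ≈⇒~ (ι-neg m) ; 0-homo = ≈⇒~ ι-0 ; 1-homo = ≈⇒~ ι-1 } }

  private module Q = AlgebraTheory quotient

  -- The quotient keeps carrier and operations, but each ring bundle has its own power function; for
  -- a variable exponent the two agree only by induction.
  ^-quotient : ∀ x n → x ^ n ≡ x Q.^ n
  ^-quotient x zero    = refl
  ^-quotient x (suc n) = cong (x *_) (^-quotient x n)

  geometric-quotient : ∀ n x → geometric n x ≡ Q.geometric n x
  geometric-quotient zero    x = refl
  geometric-quotient (suc n) x = cong (λ y → 1# + x * y) (geometric-quotient n x)

-- Finite sums and products over lists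

module ListSums (𝓐 : ℤ-Algebra) where
  open AlgebraTheory 𝓐

  Σᴸ : {A : Set} → (A → Carrier) → List A → Carrier
  Σᴸ f = foldr (λ x acc → f x + acc) 0#

  Σᴸ-++ : ∀ {A : Set} (f : A → Carrier) xs ys → Σᴸ f (xs ++ ys) ≈ Σᴸ f xs + Σᴸ f ys
  Σᴸ-++ f []       ys = ≈-sym (+-identityˡ _)
  Σᴸ-++ f (x ∷ xs) ys = ≈-trans (+-congˡ (Σᴸ-++ f xs ys)) (≈-sym (+-assoc _ _ _))

  Σᴸ-↭ : ∀ {A : Set} (f : A → Carrier) {xs ys} → xs ↭ ys → Σᴸ f xs ≈ Σᴸ f ys
  Σᴸ-↭ f Perm.refl         = ≈-refl
  Σᴸ-↭ f (Perm.prep x e)   = +-congˡ (Σᴸ-↭ f e)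
  Σᴸ-↭ f (Perm.swap x y e) = ≈-trans (≈-sym (+-assoc _ _ _)) (≈-trans (+-cong (+-comm _ _) (Σᴸ-↭ f e)) (+-assoc _ _ _))
  Σᴸ-↭ f (Perm.trans e e′) = ≈-trans (Σᴸ-↭ f e) (Σᴸ-↭ f e′)

  Πᴸ : {A : Set} → (A → Carrier) → List A → Carrier
  Πᴸ f = foldr (λ x acc → f x * acc) 1#

  Πᴸ-cong : ∀ {A : Set} {f g : A → Carrier} → (∀ x → f x ≈ g x) → ∀ xs → Πᴸ f xs ≈ Πᴸ g xs
  Πᴸ-cong f≈g []       = ≈-refl
  Πᴸ-cong f≈g (x ∷ xs) = *-cong (f≈g x) (Πᴸ-cong f≈g xs)

  Πᴸ-1 : ∀ {A : Set} (xs : List A) → Πᴸ (λ _ → 1#) xs ≈ 1#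
  Πᴸ-1 []       = ≈-refl
  Πᴸ-1 (x ∷ xs) = ≈-trans (*-identityˡ _) (Πᴸ-1 xs)

  Πᴸ-* : ∀ {A : Set} (f g : A → Carrier) xs → Πᴸ (λ x → f x * g x) xs ≈ Πᴸ f xs * Πᴸ g xs
  Πᴸ-* f g []       = ≈-sym (*-identityˡ 1#)
  Πᴸ-* f g (x ∷ xs) = ≈-trans (*-congˡ (Πᴸ-* f g xs))
    (solve 4 (λ a b c d → (a :* b) :* (c :* d) := (a :* c) :* (b :* d)) ≈-refl (f x) (g x) (Πᴸ f xs) (Πᴸ g xs))

  Πᴸ-swap : ∀ {A B : Set} (f : A → B → Carrier) xs ys →
            Πᴸ (λ x → Πᴸ (f x) ys) xs ≈ Πᴸ (λ y → Πᴸ (λ x → f x y) xs) ys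
  Πᴸ-swap f []       ys = ≈-sym (Πᴸ-1 ys)
  Πᴸ-swap f (x ∷ xs) ys = ≈-trans (*-congˡ (Πᴸ-swap f xs ys)) (≈-sym (Πᴸ-* (f x) (λ y → Πᴸ (λ x → f x y) xs) ys))

  Πᴸ-++ : ∀ {A : Set} (f : A → Carrier) xs ys → Πᴸ f (xs ++ ys) ≈ Πᴸ f xs * Πᴸ f ys
  Πᴸ-++ f []       ys = ≈-sym (*-identityˡ _)
  Πᴸ-++ f (x ∷ xs) ys = ≈-trans (*-congˡ (Πᴸ-++ f xs ys)) (≈-sym (*-assoc _ _ _))

  Πᴸ-concatMap : ∀ {A B : Set} (f : B → Carrier) (h : A → List B) xs →
                 Πᴸ f (concatMap h xs) ≈ Πᴸ (λ x → Πᴸ f (h x)) xs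
  Πᴸ-concatMap f h []       = ≈-refl
  Πᴸ-concatMap f h (x ∷ xs) = ≈-trans (Πᴸ-++ f (h x) (concatMap h xs)) (*-congˡ (Πᴸ-concatMap f h xs))

  Πᴸ-map : ∀ {A B : Set} (f : B → Carrier) (h : A → B) xs → Πᴸ f (map h xs) ≈ Πᴸ (f ∘ h) xs
  Πᴸ-map f h []       = ≈-refl
  Πᴸ-map f h (x ∷ xs) = *-congˡ (Πᴸ-map f h xs)

  -- Once the exponent ω_L is spread out as one conditional factor per prime, the product over
  -- tuples can be exchanged with the product over primes.
  when : {P : Set} → Dec P → Carrier → Carrier
  when (yes _) v = v
  when (no _)  v = 1#

  when-yes : ∀ {P : Set} (P? : Dec P) {v} → P → when P? v ≈ v
  when-yes (yes _) _ = ≈-refl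
  when-yes (no ¬p) p = ⊥-elim (¬p p)

  when-no : ∀ {P : Set} (P? : Dec P) {v} → ¬ P → when P? v ≈ 1#
  when-no (yes p) ¬p = ⊥-elim (¬p p)
  when-no (no _)  _  = ≈-refl

  when-cong : ∀ {P : Set} (P? : Dec P) {v w} → v ≈ w → when P? v ≈ when P? w
  when-cong (yes _) e = e
  when-cong (no _)  e = ≈-refl

  when-× : ∀ {P Q R : Set} (P? : Dec P) (Q? : Dec Q) (R? : Dec R) → (R → P × Q) → (P → Q → R) →
           ∀ {v} → when R? v ≈ when P? (when Q? v)
  when-× (yes p) (yes q) R? _  to = when-yes R? (to p q)
  when-× (yes p) (no ¬q) R? from _ = when-no R? (¬q ∘ proj₂ ∘ from)
  when-× (no ¬p) Q?      R? from _ = when-no R? (¬p ∘ proj₁ ∘ from)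

  Πᴸ-when-no : ∀ {A : Set} {P : A → Set} (P? : ∀ x → Dec (P x)) (f : A → Carrier) {xs} → All (¬_ ∘ P) xs →
               Πᴸ (λ x → when (P? x) (f x)) xs ≈ 1#
  Πᴸ-when-no P? f []         = ≈-refl
  Πᴸ-when-no P? f (¬p ∷ ¬ps) = ≈-trans (*-cong (when-no (P? _) ¬p) (Πᴸ-when-no P? f ¬ps)) (*-identityˡ 1#)

  Πᴸ-when-unique : ∀ {A : Set} {P : A → Set} (P? : ∀ x → Dec (P x)) (f : A → Carrier) {xs a} → Unique xs → a ∈ xs → P a →
                   (∀ {x} → x ∈ xs → P x → x ≡ a) → Πᴸ (λ x → when (P? x) (f x)) xs ≈ f a
  Πᴸ-when-unique P? f (a∉ ∷ _) (here refl) p only = ≈-trans (*-cong (when-yes (P? _) p)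
    (Πᴸ-when-no P? f (All.tabulate λ x∈ px → All.lookup a∉ x∈ (≡.sym (only (there x∈) px))))) (*-identityʳ _)
  Πᴸ-when-unique P? f (x∉ ∷ unique) (there a∈) p only = ≈-trans (*-cong
    (when-no (P? _) λ px → All.lookup x∉ a∈ (only (here refl) px))
    (Πᴸ-when-unique P? f unique a∈ p (only ∘ there))) (*-identityˡ _)

polyAlgebra : ℤ-Algebra
polyAlgebra = record
  { commutativeRing = polyRing
  ; fromℤ = record
    { ⟦_⟧    = const
    ; +-homo = λ _ _ → ≈ₚ-refl
    ; *-homo = λ m n → ∷-cong (≡.sym (ℤ.+-identityʳ _)) ≈ₚ-refl
    ; -‿homo = λ m → ∷-cong (≡.sym (ℤ.-1*i≡-i m)) ≈ₚ-refl
    ; 0-homo = 0∷[]≈[]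
    ; 1-homo = ≈ₚ-refl } }

intAlgebra : ℤ-Algebra
intAlgebra = record
  { commutativeRing = ℤ.+-*-commutativeRing
  ; fromℤ = record
    { ⟦_⟧ = λ m → m ; +-homo = λ _ _ → refl ; *-homo = λ _ _ → refl
    ; -‿homo = λ _ → refl ; 0-homo = refl ; 1-homo = refl } }

-- Division by monic polynomials

open _≈ₚ_
module ℤ[X] = AlgebraTheory polyAlgebra

-- Trailing zeros prevent reading the degree off the length of a list. The coefficient `c` may
-- itself be 0, so `Lead-unique` asks for nonzero values separately.
record Lead (k : ℕ) (c : ℤ) (P : Poly) : Set where
  constructor lead
  field
    top   : coeff P k ≡ c
    above : ∀ {i} → k < i → coeff P i ≡ 0ℤ

open Lead

Lead-resp : ∀ {k c P Q} → P ≈ₚ Q → Lead k c P → Lead k c Q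
Lead-resp e l = lead (≡.trans (≡.sym (at e _)) (top l)) λ k<i → ≡.trans (≡.sym (at e _)) (above l k<i)

Lead-unique : ∀ {k j c d P} → c ≢ 0ℤ → d ≢ 0ℤ → Lead k c P → Lead j d P → k ≡ j × c ≡ d
Lead-unique {k} {j} c≢0 d≢0 l l′ with ℕP.<-cmp k j
... | tri< k<j _ _ = ⊥-elim (d≢0 (≡.trans (≡.sym (top l′)) (above l k<j)))
... | tri> _ _ j<k = ⊥-elim (c≢0 (≡.trans (≡.sym (top l)) (above l′ j<k)))
... | tri≈ _ refl _ = refl , ≡.trans (≡.sym (top l)) (top l′)

zeroOrLead : ∀ P → P ≈ₚ [] ⊎ ∃[ k ] ∃[ c ] (c ≢ 0ℤ × Lead k c P)
zeroOrLead [] = inj₁ ≈ₚ-refl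
zeroOrLead (a ∷ P) with zeroOrLead P
... | inj₂ (k , c , c≢0 , l) = inj₂ (suc k , c , c≢0 , lead (top l) λ { (s≤s k<i) → above l k<i })
... | inj₁ P≈0 with a ℤ.≟ 0ℤ
...   | yes refl = inj₁ (≈ₚ-trans (∷-cong refl P≈0) 0∷[]≈[])
...   | no a≢0   = inj₂ (0 , a , a≢0 , lead refl λ { (s≤s {n = i} _) → at P≈0 i })

Lead-*ₚ : ∀ {k j c P Q} → Lead k 1ℤ P → Lead j c Q → Lead (k ℕ.+ j) c (P *ₚ Q)
Lead-*ₚ {P = []} l m with top l
... | ()
Lead-*ₚ {zero} {P = a ∷ P} {Q} l m = Lead-resp (≈ₚ-sym P*Q≈Q) m
  where
  P*Q≈Q : (a ∷ P) *ₚ Q ≈ₚ Q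
  P*Q≈Q = ≈ₚ-trans
    (*ₚ-cong {a ∷ P} {const 1ℤ} {Q} (∷-cong {P = P} (top l) (coeffwise λ i → above l (s≤s z≤n))) ≈ₚ-refl)
    (*ₚ-identityˡ Q)
Lead-*ₚ {suc k} {j} {c} {a ∷ P} {Q} l m = lead
  (≡.trans (drop-scale (s≤s (ℕP.m≤n+m j k))) (top ih))
  λ { (s≤s k+j<i) → ≡.trans (drop-scale (s≤s (ℕP.≤-trans (ℕP.m≤n+m j k) (ℕP.<⇒≤ k+j<i)))) (above ih k+j<i) }
  where
  ih : Lead (k ℕ.+ j) c (P *ₚ Q)
  ih = Lead-*ₚ {P = P} (lead (top l) λ k<i → above l (s≤s k<i)) m
  -- Above degree j the row `scale a Q` contributes nothing, and what remains is `P *ₚ Q` shifted by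
  -- one place.
  drop-scale : ∀ {i} → j < suc i → coeff ((a ∷ P) *ₚ Q) (suc i) ≡ coeff (P *ₚ Q) i
  drop-scale {i} j<i = ≡.trans (coeff-∷-*ₚ a P Q (suc i))
    (≡.trans (cong (λ x → a ℤ.* x ℤ.+ coeff (P *ₚ Q) i) (above m j<i))
    (≡.trans (cong (ℤ._+ _) (ℤ.*-zeroʳ a)) (ℤ.+-identityˡ _)))

Monic : Poly → Set
Monic P = ∃[ k ] Lead k 1ℤ P

1≢0 : 1ℤ ≢ 0ℤ
1≢0 ()

Monic-* : ∀ {P Q} → Monic P → Monic Q → Monic (P *ₚ Q)
Monic-* (k , l) (j , m) = k ℕ.+ j , Lead-*ₚ l m

Monic-cofactor : ∀ {P Q R} → Monic P → Monic R → R ≈ₚ P *ₚ Q → Monic Q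
Monic-cofactor {P} {Q} {R} (k , l) (n , m) e with zeroOrLead Q
... | inj₁ Q≈0 = ⊥-elim (1≢0 (≡.trans (≡.sym (top m)) (at (≈ₚ-trans e (≈ₚ-trans (*ₚ-congˡ P Q≈0) (*ₚ-zeroʳ P))) n)))
... | inj₂ (j , c , c≢0 , lQ) =
  j , ≡.subst (λ c → Lead j c Q) (proj₂ (Lead-unique c≢0 1≢0 (Lead-*ₚ l lQ) (Lead-resp e m))) lQ

DegreeBelow : ℕ → Poly → Set
DegreeBelow k P = ∀ {i} → k ≤ i → coeff P i ≡ 0ℤ

-- A leading term c·X^j of `Q` would survive as c in degree k + j of the product. This yields both
-- cancellation of monic factors and uniqueness of remainders.
*ₚ-small⇒≈0 : ∀ {k P Q} → Lead k 1ℤ P → DegreeBelow k (P *ₚ Q) → Q ≈ₚ []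
*ₚ-small⇒≈0 {k} {P} {Q} l small with zeroOrLead Q
... | inj₁ Q≈0 = Q≈0
... | inj₂ (j , c , c≢0 , m) = ⊥-elim (c≢0 (≡.trans (≡.sym (top (Lead-*ₚ l m))) (small (ℕP.m≤m+n k j))))

*ₚ-cancelˡ : ∀ {P Q R} → Monic P → P *ₚ Q ≈ₚ P *ₚ R → Q ≈ₚ R
*ₚ-cancelˡ {P} {Q} {R} (k , l) e = ℤ[X].x-y≈0⇒x≈y Q R (*ₚ-small⇒≈0 l λ {i} _ → at P*[Q-R]≈0 i)
  where
  open ℤ[X]
  P*[Q-R]≈0 : P *ₚ (Q -ₚ R) ≈ₚ []
  P*[Q-R]≈0 = ≈ₚ-trans (solve 3 (λ P Q R → P :* (Q :- R) := P :* Q :- P :* R) ≈-refl P Q R) (x≈y⇒x-y≈0 e)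

-- Reversal and big-endian long division

coeff-beyond : ∀ P {i} → length P ≤ i → coeff P i ≡ 0ℤ
coeff-beyond []      _        = refl
coeff-beyond (a ∷ P) (s≤s le) = coeff-beyond P le

0∷≈X* : ∀ P → 0ℤ ∷ P ≈ₚ X^ 1 *ₚ P
0∷≈X* P = ≈ₚ-sym (≈ₚ-trans (0∷-*ₚ (const 1ℤ) P) (∷-cong refl (*ₚ-identityˡ P)))

X^-homo-+ : ∀ m n → X^ (m ℕ.+ n) ≈ₚ X^ m *ₚ X^ n
X^-homo-+ zero    n = ≈ₚ-sym (*ₚ-identityˡ (X^ n))
X^-homo-+ (suc m) n = ≈ₚ-trans (∷-cong refl (X^-homo-+ m n)) (≈ₚ-sym (0∷-*ₚ (X^ m) (X^ n)))

X^-power : ∀ n → X^ n ≈ₚ X^ 1 ℤ[X].^ n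
X^-power zero    = ≈ₚ-refl
X^-power (suc n) = ≈ₚ-trans (0∷≈X* (X^ n)) (*ₚ-congˡ (X^ 1) (X^-power n))

snoc : ∀ P c → P ++ c ∷ [] ≈ₚ P +ₚ const c *ₚ X^ (length P)
snoc []      c = coeffwise λ { zero → ≡.sym (≡.trans (ℤ.+-identityʳ _) (ℤ.*-identityʳ c)) ; (suc i) → refl }
snoc (a ∷ P) c = coeffwise λ
  { zero    → ≡.sym (≡.trans (cong (ℤ._+_ a) (≡.trans (ℤ.+-identityʳ _) (ℤ.*-zeroʳ c))) (ℤ.+-identityʳ a))
  ; (suc i) → ≡.trans (at (snoc P c) i)
      (at (+ₚ-cong (≈ₚ-refl {P}) (≈ₚ-trans (const-*ₚ c (X^ (length P))) (≈ₚ-sym (+ₚ-identityʳ _)))) i) }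

reverse-∷ : ∀ c P → reverse (c ∷ P) ≈ₚ reverse P +ₚ const c *ₚ X^ (length P)
reverse-∷ c P rewrite List.unfold-reverse c P =
  ≡.subst (λ n → reverse P ++ c ∷ [] ≈ₚ reverse P +ₚ const c *ₚ X^ n) (List.length-reverse P) (snoc (reverse P) c)

reverse-beyond : ∀ P {i} → length P ≤ i → coeff (reverse P) i ≡ 0ℤ
reverse-beyond P le = coeff-beyond (reverse P) (ℕP.≤-trans (ℕP.≤-reflexive (List.length-reverse P)) le)

coeff-X^ : ∀ n → coeff (X^ n) n ≡ 1ℤ
coeff-X^ zero    = refl
coeff-X^ (suc n) = coeff-X^ n

Lead-reverse : ∀ c P → Lead (length P) c (reverse (c ∷ P))
Lead-reverse c P = lead
  (begin
    coeff (reverse (c ∷ P)) n                              ≡⟨ at (reverse-∷ c P) n ⟩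
    coeff (reverse P +ₚ const c *ₚ X^ n) n                  ≡⟨ coeff-+ₚ (reverse P) _ n ⟩
    coeff (reverse P) n ℤ.+ coeff (const c *ₚ X^ n) n       ≡⟨ cong₂ ℤ._+_ (reverse-beyond P ℕP.≤-refl) (at (const-*ₚ c (X^ n)) n) ⟩
    0ℤ ℤ.+ coeff (scale c (X^ n)) n                         ≡⟨ ℤ.+-identityˡ _ ⟩
    coeff (scale c (X^ n)) n                                ≡⟨ coeff-scale c (X^ n) n ⟩
    c ℤ.* coeff (X^ n) n                                    ≡⟨ cong (c ℤ.*_) (coeff-X^ n) ⟩
    c ℤ.* 1ℤ                                                ≡⟨ ℤ.*-identityʳ c ⟩
    c                                                       ∎)
  (reverse-beyond (c ∷ P))
  where
  open ≡-Reasoning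
  n = length P

length-subMul : ∀ c xs bs {δ} → length xs ≡ length bs ℕ.+ δ → length (subMul c xs bs) ≡ length xs
length-subMul c []       []       e = refl
length-subMul c (x ∷ xs) []       e = refl
length-subMul c (x ∷ xs) (y ∷ ys) e = cong suc (length-subMul c xs ys (ℕP.suc-injective e))

subtract-0 : ∀ c P Q → P ≈ₚ P -ₚ const c *ₚ [] *ₚ Q
subtract-0 c P Q = ≈-sym (begin
  P - const c * [] * Q  ≈⟨ +-congˡ {P} (-‿cong (*-congʳ {Q} (zeroʳ (const c)))) ⟩
  P - [] * Q            ≈⟨ +-identityʳ P ⟩
  P                     ∎)
  where open ℤ[X]

-- `subMul` aligns the two lists at their heads, that is, at their leading terms; read in
-- little-endian order this multiplies the tail of the divisor by X^δ, where δ is the surplus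
-- length.
reverse-subMul : ∀ c xs bs {δ} → length xs ≡ length bs ℕ.+ δ →
                 reverse (subMul c xs bs) ≈ₚ reverse xs -ₚ const c *ₚ reverse bs *ₚ X^ δ
reverse-subMul c []       []       {δ} e = subtract-0 c [] (X^ δ)
reverse-subMul c (x ∷ xs) []       {δ} e = subtract-0 c (reverse (x ∷ xs)) (X^ δ)
reverse-subMul c (x ∷ xs) (y ∷ ys) {δ} e = begin
  reverse (x ℤ.- c ℤ.* y ∷ subMul c xs ys)
    ≈⟨ reverse-∷ _ (subMul c xs ys) ⟩
  reverse (subMul c xs ys) + const (x ℤ.- c ℤ.* y) * X^ (length (subMul c xs ys))
    ≡⟨ cong (λ k → reverse (subMul c xs ys) + const (x ℤ.- c ℤ.* y) * X^ k) (≡.trans (length-subMul c xs ys e′) e′) ⟩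
  reverse (subMul c xs ys) + const (x ℤ.- c ℤ.* y) * X^ (length ys ℕ.+ δ)
    ≈⟨ +-cong (reverse-subMul c xs ys e′) (*-cong const-split (X^-homo-+ (length ys) δ)) ⟩
  (reverse xs - const c * reverse ys * X^ δ) + (const x - const c * const y) * (X^ (length ys) * X^ δ)
    ≈⟨ solve 7 (λ rx c ry d x y l → (rx :- c :* ry :* d) :+ (x :- c :* y) :* (l :* d)
                  := (rx :+ x :* (l :* d)) :- c :* (ry :+ y :* l) :* d) ≈-refl
         (reverse xs) (const c) (reverse ys) (X^ δ) (const x) (const y) (X^ (length ys)) ⟩
  (reverse xs + const x * (X^ (length ys) * X^ δ)) - const c * (reverse ys + const y * X^ (length ys)) * X^ δ
    ≈⟨ +-cong (+-congˡ {reverse xs} (*-congˡ {const x} (X^-homo-+ (length ys) δ)))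
              (-‿cong (*-congʳ {X^ δ} (*-congˡ {const c} (reverse-∷ y ys)))) ⟨
  (reverse xs + const x * X^ (length ys ℕ.+ δ)) - const c * reverse (y ∷ ys) * X^ δ
    ≡⟨ cong (λ k → (reverse xs + const x * X^ k) - const c * reverse (y ∷ ys) * X^ δ) e′ ⟨
  (reverse xs + const x * X^ (length xs)) - const c * reverse (y ∷ ys) * X^ δ
    ≈⟨ +-congʳ (reverse-∷ x xs) ⟨
  reverse (x ∷ xs) - const c * reverse (y ∷ ys) * X^ δ ∎
  where
  open ℤ[X]
  e′ = ℕP.suc-injective e
  const-split : const (x ℤ.- c ℤ.* y) ≈ const x - const c * const y
  const-split = ≈-trans (ι-+ x (ℤ.- (c ℤ.* y)))
    (+-congˡ {const x} (≈-trans (ι-neg (c ℤ.* y)) (-‿cong (ι-* c y))))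

-- Reversal puts the new quotient digit in degree `length q`, so the division is correct only if
-- this length is exactly the degree difference.
length-divBE : ∀ k xs bs → length xs ≤ k → length (divBE k xs bs) ≡ length xs ℕ.∸ length bs
length-divBE zero    []       bs le = ≡.sym (ℕP.0∸n≡0 (length bs))
length-divBE (suc k) []       bs le = ≡.sym (ℕP.0∸n≡0 (length bs))
length-divBE (suc k) (x ∷ xs) bs (s≤s le) with length bs ≤? length xs
... | no bs≰xs  = ≡.sym (ℕP.m≤n⇒m∸n≡0 (ℕP.≰⇒> bs≰xs))
... | yes bs≤xs = begin
  suc (length (divBE k (subMul x xs bs) bs)) ≡⟨ cong suc (length-divBE k _ bs (≡.subst (_≤ k) (≡.sym |sub|) le)) ⟩
  suc (length (subMul x xs bs) ℕ.∸ length bs) ≡⟨ cong (λ n → suc (n ℕ.∸ length bs)) |sub| ⟩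
  suc (length xs ℕ.∸ length bs)               ≡⟨ ℕP.+-∸-assoc 1 bs≤xs ⟨
  suc (length xs) ℕ.∸ length bs               ∎
  where
  open ≡-Reasoning
  |sub| = length-subMul x xs bs (≡.sym (ℕP.m+[n∸m]≡n bs≤xs))

divBE-spec : ∀ k xs bs → length xs ≤ k →
  ∃[ R ] DegreeBelow (length bs) R × reverse xs ≈ₚ reverse (1ℤ ∷ bs) *ₚ reverse (divBE k xs bs) +ₚ R
divBE-spec zero    []       bs le = [] , (λ _ → refl) , ≈ₚ-sym (≈ₚ-trans (+ₚ-identityʳ _) (*ₚ-zeroʳ (reverse (1ℤ ∷ bs))))
divBE-spec (suc k) []       bs le = [] , (λ _ → refl) , ≈ₚ-sym (≈ₚ-trans (+ₚ-identityʳ _) (*ₚ-zeroʳ (reverse (1ℤ ∷ bs))))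
divBE-spec (suc k) (x ∷ xs) bs (s≤s le) with length bs ≤? length xs
... | no bs≰xs  = reverse (x ∷ xs) , (λ bs≤i → reverse-beyond (x ∷ xs) (ℕP.≤-trans (ℕP.≰⇒> bs≰xs) bs≤i)) ,
                  ≈ₚ-sym (+ₚ-cong (*ₚ-zeroʳ (reverse (1ℤ ∷ bs))) (≈ₚ-refl {reverse (x ∷ xs)}))
... | yes bs≤xs with divBE-spec k (subMul x xs bs) bs (≡.subst (_≤ k) (≡.sym (length-subMul x xs bs (≡.sym (ℕP.m+[n∸m]≡n bs≤xs)))) le)
...   | R , small , eq = R , small , (begin
  reverse (x ∷ xs)
    ≈⟨ reverse-∷ x xs ⟩
  reverse xs + const x * X^ (length xs)
    ≡⟨ cong (λ n → reverse xs + const x * X^ n) |xs| ⟩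
  reverse xs + const x * X^ (length bs ℕ.+ δ)
    ≈⟨ +-congˡ {reverse xs} (*-congˡ {const x} (X^-homo-+ (length bs) δ)) ⟩
  reverse xs + const x * (X^ (length bs) * X^ δ)
    -- The leading term x·X^(|bs|+δ) is traded for x·X^δ times the whole divisor, minus the share of
    -- the divisor's tail, which is what `subMul` subtracts.
    ≈⟨ solve 5 (λ rx x l d rb → rx :+ x :* (l :* d) := (rx :- x :* rb :* d) :+ (rb :+ l) :* (x :* d)) ≈-refl
         (reverse xs) (const x) (X^ (length bs)) (X^ δ) (reverse bs) ⟩
  (reverse xs - const x * reverse bs * X^ δ) + (reverse bs + X^ (length bs)) * (const x * X^ δ)
    ≈⟨ +-cong (≈-trans (≈-sym (reverse-subMul x xs bs |xs|)) eq) (*-congʳ {const x * X^ δ} divisor) ⟩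
  (reverse (1ℤ ∷ bs) * reverse q + R) + reverse (1ℤ ∷ bs) * (const x * X^ δ)
    ≈⟨ solve 4 (λ b q r m → (b :* q :+ r) :+ b :* m := b :* (q :+ m) :+ r) ≈-refl (reverse (1ℤ ∷ bs)) (reverse q) R (const x * X^ δ) ⟩
  reverse (1ℤ ∷ bs) * (reverse q + const x * X^ δ) + R
    ≡⟨ cong (λ n → reverse (1ℤ ∷ bs) * (reverse q + const x * X^ n) + R) |q| ⟨
  reverse (1ℤ ∷ bs) * (reverse q + const x * X^ (length q)) + R
    ≈⟨ +-congʳ {R} (*-congˡ {reverse (1ℤ ∷ bs)} (reverse-∷ x q)) ⟨
  reverse (1ℤ ∷ bs) * reverse (x ∷ q) + R ∎)
  where
  open ℤ[X]
  δ = length xs ℕ.∸ length bs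
  q = divBE k (subMul x xs bs) bs
  |xs| : length xs ≡ length bs ℕ.+ δ
  |xs| = ≡.sym (ℕP.m+[n∸m]≡n bs≤xs)
  |q| : length q ≡ δ
  |q| = ≡.trans (length-divBE k _ bs (≡.subst (_≤ k) (≡.sym (length-subMul x xs bs |xs|)) le))
                (cong (ℕ._∸ length bs) (length-subMul x xs bs |xs|))
  divisor : reverse bs + X^ (length bs) ≈ reverse (1ℤ ∷ bs)
  divisor = ≈-sym (≈-trans (reverse-∷ 1ℤ bs) (+-congˡ {reverse bs} (*-identityˡ (X^ (length bs)))))

reverse-dropZeros : ∀ xs → reverse (dropZeros xs) ≈ₚ reverse xs
reverse-dropZeros []                 = ≈ₚ-refl
reverse-dropZeros (+ zero ∷ xs)      = ≈ₚ-trans (reverse-dropZeros xs) (≈ₚ-sym (≈ₚ-trans (reverse-∷ 0ℤ xs)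
  (≈ₚ-trans (+ₚ-cong (≈ₚ-refl {reverse xs}) (≈ₚ-trans (*ₚ-cong {Q = X^ (length xs)} 0∷[]≈[] ≈ₚ-refl) ≈ₚ-refl)) (+ₚ-identityʳ _))))
reverse-dropZeros (+ suc n ∷ xs)     = ≈ₚ-refl
reverse-dropZeros (-[1+ n ] ∷ xs)    = ≈ₚ-refl

head-dropZeros : ∀ xs {y ys} → dropZeros xs ≡ y ∷ ys → y ≢ 0ℤ
head-dropZeros (+ zero ∷ xs)   e    = head-dropZeros xs e
head-dropZeros (+ suc n ∷ xs)  refl ()
head-dropZeros (-[1+ n ] ∷ xs) refl ()

length-dropZeros : ∀ xs → length (dropZeros xs) ≤ length xs
length-dropZeros []              = z≤n
length-dropZeros (+ zero ∷ xs)   = ℕP.≤-trans (length-dropZeros xs) (ℕP.n≤1+n _)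
length-dropZeros (+ suc n ∷ xs)  = ℕP.≤-refl
length-dropZeros (-[1+ n ] ∷ xs) = ℕP.≤-refl

reverse-dropZeros-reverse : ∀ P → reverse (dropZeros (reverse P)) ≈ₚ P
reverse-dropZeros-reverse P = ≡.subst (reverse (dropZeros (reverse P)) ≈ₚ_) (List.reverse-involutive P) (reverse-dropZeros (reverse P))

divMonic-spec : ∀ A {B k} → Lead k 1ℤ B → ∃[ R ] DegreeBelow k R × A ≈ₚ B *ₚ divMonic A B +ₚ R
divMonic-spec A {B} {k} l with dropZeros (reverse B) | head-dropZeros (reverse B) | reverse-dropZeros-reverse B
... | []     | _   | 0≈B = ⊥-elim (1≢0 (≡.trans (≡.sym (top l)) (≡.sym (at 0≈B k))))
... | y ∷ bs | y≢0 | e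
  -- `divMonic` discards the head y without looking at it. As y is nonzero, uniqueness of the
  -- leading term forces y = 1 and `length bs` = k.
  with refl , refl ← Lead-unique (y≢0 refl) 1≢0 (Lead-resp e (Lead-reverse y bs)) l
  with R , small , eq ← divBE-spec (length A) (dropZeros (reverse A)) bs
         (ℕP.≤-trans (length-dropZeros (reverse A)) (ℕP.≤-reflexive (List.length-reverse A)))
  = R , small , ≈ₚ-trans (≈ₚ-sym (reverse-dropZeros-reverse A))
      (≈ₚ-trans eq (+ₚ-cong (*ₚ-cong {Q = reverse (divBE (length A) (dropZeros (reverse A)) bs)} e ≈ₚ-refl) (≈ₚ-refl {R})))

-- The integer multiple N clears the denominators of a Bézout identity over ℚ.
divMonic-exact : ∀ {A B W N} → Monic B → N ≢ 0ℤ → const N *ₚ A ≈ₚ B *ₚ W → A ≈ₚ B *ₚ divMonic A B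
divMonic-exact {A} {B} {W} {N} (k , l) N≢0 e with divMonic-spec A l
... | R , small , A≈BQ+R = ≈-trans A≈BQ+R (≈-trans (+-congˡ {B * Q} R≈0) (+-identityʳ (B * Q)))
  where
  open ℤ[X]
  Q = divMonic A B
  -- The right side has degree below k, so the monic `B` forces W = N·Q; then N·R = 0, and R = 0
  -- since N is not 0.
  B*D≈NR : B * (W - const N * Q) ≈ const N * R
  B*D≈NR = begin
    B * (W - const N * Q)                     ≈⟨ solve 4 (λ b w n q → b :* (w :- n :* q) := b :* w :- n :* (b :* q)) ≈-refl B W (const N) Q ⟩
    B * W - const N * (B * Q)                 ≈⟨ +-congʳ (≈-sym e) ⟩
    const N * A - const N * (B * Q)           ≈⟨ +-congʳ (*-congˡ {const N} A≈BQ+R) ⟩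
    const N * (B * Q + R) - const N * (B * Q) ≈⟨ solve 3 (λ n c r → n :* (c :+ r) :- n :* c := n :* r) ≈-refl (const N) (B * Q) R ⟩
    const N * R                               ∎
  coeff-NR : ∀ i → coeff (const N * R) i ≡ N ℤ.* coeff R i
  coeff-NR i = ≡.trans (at (const-*ₚ N R) i) (coeff-scale N R i)
  D≈0 : W - const N * Q ≈ []
  D≈0 = *ₚ-small⇒≈0 l λ {i} k≤i →
    ≡.trans (at B*D≈NR i) (≡.trans (coeff-NR i) (≡.trans (cong (N ℤ.*_) (small k≤i)) (ℤ.*-zeroʳ N)))
  R≈0 : R ≈ []
  R≈0 = coeffwise λ i → N*c≡0⇒c≡0 (≡.trans (≡.sym (coeff-NR i))
    (at (≈-trans (≈-sym B*D≈NR) (≈-trans (*ₚ-congˡ B D≈0) (*ₚ-zeroʳ B))) i))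
    where
    N*c≡0⇒c≡0 : ∀ {c} → N ℤ.* c ≡ 0ℤ → c ≡ 0ℤ
    N*c≡0⇒c≡0 {c} z with ℤ.i*j≡0⇒i≡0∨j≡0 N z
    ... | inj₁ N≡0 = ⊥-elim (N≢0 N≡0)
    ... | inj₂ c≡0 = c≡0

-- Cyclotomic polynomials

∈-range1⁺ : ∀ {a n} → 1 ≤ a → a ≤ n → a ∈ range1 n
∈-range1⁺ {suc a} _ a<n = ∈-map⁺ suc (∈-upTo⁺ a<n)

∈-range1⁻ : ∀ {a n} → a ∈ range1 n → 1 ≤ a × a ≤ n
∈-range1⁻ a∈ with ∈-map⁻ suc a∈
... | _ , i∈ , refl = s≤s z≤n , ∈-upTo⁻ i∈

range1-sorted : ∀ n → AllPairs _<_ (range1 n)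
range1-sorted n = AllPairs.map⁺ (AllPairs.applyUpTo⁺₁ _ n λ i<j _ → s≤s i<j)

-- The bound `n ∸ 1` makes this, at `suc m`, the very list filtered in `cycloList (suc m)`.
properDivisors : ℕ → List ℕ
properDivisors n = filter (_∣? n) (range1 (n ∸ 1))

∈-properDivisors⁺ : ∀ {e n} → 1 ≤ e → e < n → e ∣ n → e ∈ properDivisors n
∈-properDivisors⁺ {n = suc n} 1≤e (s≤s e≤n) e∣n = ∈-filter⁺ (_∣? suc n) (∈-range1⁺ 1≤e e≤n) e∣n

∈-properDivisors⁻ : ∀ {e n} → 1 ≤ n → e ∈ properDivisors n → 1 ≤ e × e < n × e ∣ n
∈-properDivisors⁻ {n = suc n} _ e∈ with ∈-filter⁻ (_∣? suc n) e∈
... | e∈range , e∣n = proj₁ (∈-range1⁻ e∈range) , s≤s (proj₂ (∈-range1⁻ e∈range)) , e∣n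

lookupD-++ˡ : ∀ Ps Qs {i} → i < length Ps → lookupD (Ps ++ Qs) i ≡ lookupD Ps i
lookupD-++ˡ (P ∷ Ps) Qs {zero}  _         = refl
lookupD-++ˡ (P ∷ Ps) Qs {suc i} (s≤s i<n) = lookupD-++ˡ Ps Qs i<n

lookupD-snoc : ∀ Ps Q → lookupD (Ps ++ Q ∷ []) (length Ps) ≡ Q
lookupD-snoc []       Q = refl
lookupD-snoc (P ∷ Ps) Q = lookupD-snoc Ps Q

length-cycloList : ∀ m → length (cycloList m) ≡ m
length-cycloList zero    = refl
length-cycloList (suc m) = ≡.trans (List.length-++ (cycloList m))
  (≡.trans (cong (ℕ._+ 1) (length-cycloList m)) (ℕP.+-comm m 1))

-- Later stages only append, so an entry keeps the value it had when it was last in the list.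
lookupD-cycloList : ∀ m {i} → i < m → lookupD (cycloList m) i ≡ Φ (suc i)
lookupD-cycloList (suc m) {i} (s≤s i≤m) with ℕP.m≤n⇒m<n∨m≡n i≤m
... | inj₁ i<m  = ≡.trans (lookupD-++ˡ (cycloList m) _ (≡.subst (i <_) (≡.sym (length-cycloList m)) i<m)) (lookupD-cycloList m i<m)
... | inj₂ refl = refl

Φ-proper : ℕ → Poly
Φ-proper m = ∏ₚ (map Φ (properDivisors m))

unity : ℕ → Poly
unity m = X^ m -ₚ const 1ℤ

Φ-recursion : ∀ m → Φ (suc m) ≡ divMonic (unity (suc m)) (Φ-proper (suc m))
Φ-recursion m = begin
  lookupD (cycloList (suc m)) m                        ≡⟨ cong (lookupD (cycloList (suc m))) (length-cycloList m) ⟨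
  lookupD (cycloList (suc m)) (length (cycloList m))   ≡⟨ lookupD-snoc (cycloList m) _ ⟩
  divMonic (unity (suc m)) (∏ₚ (map (λ e → lookupD (cycloList m) (e ∸ 1)) (properDivisors (suc m))))
    ≡⟨ cong (divMonic (unity (suc m)) ∘ ∏ₚ) (List.map-cong-local (All.tabulate agrees)) ⟩
  divMonic (unity (suc m)) (Φ-proper (suc m))          ∎
  where
  open ≡-Reasoning
  agrees : ∀ {e} → e ∈ properDivisors (suc m) → lookupD (cycloList m) (e ∸ 1) ≡ Φ e
  agrees {e} e∈ with ∈-properDivisors⁻ {n = suc m} (s≤s z≤n) e∈
  agrees {suc e} e∈ | _ , s≤s e<m , _ = lookupD-cycloList m e<m

infix 4 _∣ₚ_

record _∣ₚ_ (P Q : Poly) : Set where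
  constructor divides
  field
    cofactor      : Poly
    factorisation : Q ≈ₚ P *ₚ cofactor

open _∣ₚ_

∣ₚ-trans : ∀ {P Q R} → P ∣ₚ Q → Q ∣ₚ R → P ∣ₚ R
∣ₚ-trans {P} {Q} {R} (divides C e) (divides D f) = divides (C *ₚ D) $ ≈ₚ-trans f (≈ₚ-trans (*ₚ-cong {Q = D} e ≈ₚ-refl) (*ₚ-assoc P C D))

∈⇒∣ₚ∏ : ∀ {P Ps} → P ∈ Ps → P ∣ₚ ∏ₚ Ps
∈⇒∣ₚ∏ {P} {_ ∷ Ps} (here refl) = divides (∏ₚ Ps) ≈ₚ-refl
∈⇒∣ₚ∏ {P} {Q ∷ Ps} (there P∈) with ∈⇒∣ₚ∏ P∈
... | divides C e = divides (Q *ₚ C) $ ≈-trans (*-congˡ {Q} e) (solve 3 (λ p q c → q :* (p :* c) := p :* (q :* c)) ≈-refl P Q C)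
  where open ℤ[X]

-- A Bézout identity with denominators cleared. The multiple cannot be fixed at 1: the ideal (X - 1,
-- X + 1) generated by Φ₁ and Φ₂ contains 2 but not 1.
record CoprimeOverℚ (P Q : Poly) : Set where
  constructor bézout
  field
    {multiple} : ℤ
    nonzero    : multiple ≢ 0ℤ
    A B        : Poly
    identity   : const multiple ≈ₚ P *ₚ A +ₚ Q *ₚ B

CoprimeOverℚ-sym : ∀ {P Q} → CoprimeOverℚ P Q → CoprimeOverℚ Q P
CoprimeOverℚ-sym {P} {Q} (bézout N≢0 A B e) = bézout N≢0 B A $ ≈ₚ-trans e (+ₚ-comm (P *ₚ A) (Q *ₚ B))

*-nonzero : ∀ {M N} → M ≢ 0ℤ → N ≢ 0ℤ → M ℤ.* N ≢ 0ℤ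
*-nonzero {M} M≢0 N≢0 z with ℤ.i*j≡0⇒i≡0∨j≡0 M z
... | inj₁ M≡0 = M≢0 M≡0
... | inj₂ N≡0 = N≢0 N≡0

-- When the identities for `Q` and for `∏ₚ Qs` are multiplied, the only term without a factor `P`
-- carries the full product.
CoprimeOverℚ-∏ₚ : ∀ {P Qs} → All (CoprimeOverℚ P) Qs → CoprimeOverℚ P (∏ₚ Qs)
CoprimeOverℚ-∏ₚ {P} [] = bézout 1≢0 [] (const 1ℤ) $
  ≈-sym (≈-trans (+-congʳ {const 1ℤ} (zeroʳ P)) (*-identityˡ (const 1ℤ)))
  where open ℤ[X]
CoprimeOverℚ-∏ₚ {P} {Q ∷ Qs} (bézout {M} M≢0 A B e ∷ coprime) with CoprimeOverℚ-∏ₚ coprime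
... | bézout {N} N≢0 C D f = bézout (*-nonzero M≢0 N≢0) (A * (P * C + R * D) + Q * B * C) (B * D) (begin
  const (M ℤ.* N)                        ≈⟨ ι-* M N ⟩
  const M * const N                      ≈⟨ *-cong e f ⟩
  (P * A + Q * B) * (P * C + R * D)      ≈⟨ solve 7 (λ p q r a b c d → (p :* a :+ q :* b) :* (p :* c :+ r :* d)
                                              := p :* (a :* (p :* c :+ r :* d) :+ q :* b :* c) :+ q :* r :* (b :* d))
                                              ≈-refl P Q R A B C D ⟩
  P * (A * (P * C + R * D) + Q * B * C) + Q * R * (B * D) ∎)
  where
  open ℤ[X]
  R = ∏ₚ Qs

∏ₚ-monic : ∀ {Ps} → All Monic Ps → Monic (∏ₚ Ps)
∏ₚ-monic []       = 0 , lead refl λ { (s≤s _) → refl }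
∏ₚ-monic (m ∷ ms) = Monic-* m (∏ₚ-monic ms)

-- From N = PA + QB with Y = PZ = QZ′ follows N·Y = PQ(AZ′ + BZ); since PQ is monic,
-- `divMonic-exact` removes N.
∏ₚ-∣ₚ : ∀ {Ps Y} → All Monic Ps → AllPairs CoprimeOverℚ Ps → All (_∣ₚ Y) Ps → ∏ₚ Ps ∣ₚ Y
∏ₚ-∣ₚ {Y = Y} [] [] [] = divides Y $ ≈ₚ-sym (*ₚ-identityˡ Y)
∏ₚ-∣ₚ {P ∷ Ps} {Y} (m ∷ ms) (c ∷ cs) (divides Z Y≈PZ ∷ ds) with ∏ₚ-∣ₚ ms cs ds | CoprimeOverℚ-∏ₚ c
... | divides Z′ Y≈QZ′ | bézout {N} N≢0 A B e = divides _ $ divMonic-exact {W = A * Z′ + B * Z} (∏ₚ-monic (m ∷ ms)) N≢0 (begin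
  const N * Y                         ≈⟨ *-congʳ {Y} e ⟩
  (P * A + Q * B) * Y                 ≈⟨ distribʳ Y (P * A) (Q * B) ⟩
  P * A * Y + Q * B * Y               ≈⟨ +-cong (*-congˡ {P * A} Y≈QZ′) (*-congˡ {Q * B} Y≈PZ) ⟩
  P * A * (Q * Z′) + Q * B * (P * Z)  ≈⟨ solve 6 (λ p q a b z z′ → p :* a :* (q :* z′) :+ q :* b :* (p :* z)
                                           := p :* q :* (a :* z′ :+ b :* z)) ≈-refl P Q A B Z Z′ ⟩
  P * Q * (A * Z′ + B * Z)            ∎)
  where
  open ℤ[X]
  Q = ∏ₚ Ps

unity-Lead : ∀ m → 1 ≤ m → Lead m 1ℤ (unity m)
unity-Lead (suc m) _ = lead
  (≡.trans (coeff--ₚ (X^ (suc m)) (const 1ℤ) (suc m)) (≡.trans (ℤ.+-identityʳ _) (coeff-X^ (suc m))))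
  λ { {suc i} (s≤s m<i) → ≡.trans (coeff--ₚ (X^ (suc m)) (const 1ℤ) (suc i))
        (≡.trans (ℤ.+-identityʳ _) (coeff-X^-above m m<i)) }
  where
  coeff-X^-above : ∀ m {i} → m < i → coeff (X^ m) i ≡ 0ℤ
  coeff-X^-above zero    (s≤s _)   = refl
  coeff-X^-above (suc m) (s≤s m<i) = coeff-X^-above m m<i

X^-^ : ∀ e k → X^ e ℤ[X].^ k ≈ₚ X^ (e ℕ.* k)
X^-^ e k = begin
  X^ e ^ k            ≈⟨ ^-congˡ k (X^-power e) ⟩
  (X^ 1 ^ e) ^ k      ≈⟨ ^-assocʳ (X^ 1) e k ⟩
  X^ 1 ^ (e ℕ.* k)    ≈⟨ X^-power (e ℕ.* k) ⟨
  X^ (e ℕ.* k)        ∎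
  where open ℤ[X]

unity-factor : ∀ e k → unity (e ℕ.* k) ≈ₚ unity e *ₚ ℤ[X].geometric k (X^ e)
unity-factor e k = begin
  unity (e ℕ.* k)             ≈⟨ +-congʳ (X^-^ e k) ⟨
  X^ e ^ k - 1#               ≈⟨ geometric-sum k (X^ e) ⟨
  geometric k (X^ e) * unity e ≈⟨ *-comm (geometric k (X^ e)) (unity e) ⟩
  unity e * geometric k (X^ e) ∎
  where open ℤ[X]

unity-∣ₚ : ∀ {e m} → e ∣ m → unity e ∣ₚ unity m
unity-∣ₚ {e} (ℕD.divides k refl) = divides _ $ ≡.subst (λ n → unity n ≈ₚ unity e *ₚ ℤ[X].geometric k (X^ e)) (ℕP.*-comm e k) (unity-factor e k)

-- The fields are proved together by strong induction. `coprime` ranges over all f < m and not just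
-- divisors of m, since two divisors of one number need not divide each other.
record Cyclotomic (m : ℕ) : Set where
  field
    positive       : 1 ≤ m
    monic          : Monic (Φ m)
    unity-product  : unity m ≈ₚ Φ m *ₚ Φ-proper m
    coprime        : ∀ {f} → 1 ≤ f → f < m → CoprimeOverℚ (Φ m) (Φ f)

  Φ∣unity : Φ m ∣ₚ unity m
  Φ∣unity = divides (Φ-proper m) unity-product

open Cyclotomic

properDivisors-coprime : ∀ {es} → AllPairs _<_ es → All Cyclotomic es → AllPairs (CoprimeOverℚ on Φ) es
properDivisors-coprime []           []       = []
properDivisors-coprime (e< ∷ sorted) (c ∷ cs) =
  All.zipWith (λ (e<f , c′) → CoprimeOverℚ-sym (coprime c′ (positive c) e<f)) (e< , cs) ∷ properDivisors-coprime sorted cs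

module CyclotomicStep (m : ℕ) (1≤m : 1 ≤ m) (ih : ∀ {k} → k < m → 1 ≤ k → Cyclotomic k) where

  proper-cyclotomic : ∀ {k} → k ≤ m → 1 ≤ k → All Cyclotomic (properDivisors k)
  proper-cyclotomic k≤m 1≤k = All.tabulate λ e∈ →
    let 1≤e , e<k , _ = ∈-properDivisors⁻ 1≤k e∈ in ih (ℕP.<-≤-trans e<k k≤m) 1≤e

  proper-coprime : ∀ {k} → k ≤ m → 1 ≤ k → AllPairs (CoprimeOverℚ on Φ) (properDivisors k)
  proper-coprime {k} k≤m 1≤k = properDivisors-coprime (AllPairs.filter⁺ (_∣? k) (range1-sorted (k ∸ 1))) (proper-cyclotomic k≤m 1≤k)

  Φ-proper-monic : Monic (Φ-proper m)
  Φ-proper-monic = ∏ₚ-monic (All.map⁺ (All.map monic (proper-cyclotomic ℕP.≤-refl 1≤m)))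

  Φ-proper∣unity : Φ-proper m ∣ₚ unity m
  Φ-proper∣unity = ∏ₚ-∣ₚ (All.map⁺ (All.map monic (proper-cyclotomic ℕP.≤-refl 1≤m)))
    (AllPairs.map⁺ (proper-coprime ℕP.≤-refl 1≤m))
    (All.map⁺ (All.tabulate λ e∈ → let 1≤e , e<m , e∣m = ∈-properDivisors⁻ 1≤m e∈ in
      ∣ₚ-trans (Φ∣unity (ih e<m 1≤e)) (unity-∣ₚ e∣m)))

  Φ-factorisation : unity m ≈ₚ Φ m *ₚ Φ-proper m
  Φ-factorisation = ≈ₚ-trans (≈ₚ-trans
    (divMonic-exact {W = cofactor Φ-proper∣unity} {1ℤ} Φ-proper-monic 1≢0
      (≈ₚ-trans (*ₚ-identityˡ (unity m)) (factorisation Φ-proper∣unity)))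
    (≡.subst (λ P → Φ-proper m *ₚ divMonic (unity m) (Φ-proper m) ≈ₚ Φ-proper m *ₚ P) (recursion m 1≤m) ≈ₚ-refl))
    (*ₚ-comm (Φ-proper m) (Φ m))
    where
    recursion : ∀ m → 1 ≤ m → divMonic (unity m) (Φ-proper m) ≡ Φ m
    recursion (suc m) _ = ≡.sym (Φ-recursion m)

  Φ-monic : Monic (Φ m)
  Φ-monic = Monic-cofactor Φ-proper-monic (m , unity-Lead m 1≤m)
    (≈ₚ-trans Φ-factorisation (*ₚ-comm (Φ m) (Φ-proper m)))

  -- Every divisor of g, including g, is a proper divisor of m. The corresponding Φ_h are pairwise
  -- coprime factors of `Φ-proper m`, and their product is X^g - 1.
  unity∣Φ-proper : ∀ {g} → 1 ≤ g → g < m → g ∣ m → unity g ∣ₚ Φ-proper m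
  unity∣Φ-proper {g} 1≤g g<m g∣m = divides C $ ≈ₚ-trans e (*ₚ-cong {Q = C} (≈ₚ-sym (unity-product (ih g<m 1≤g))) ≈ₚ-refl)
    where
    g≤m = ℕP.<⇒≤ g<m
    Φ-divides : ∀ {h} → 1 ≤ h → h ≤ g → h ∣ g → Φ h ∣ₚ Φ-proper m
    Φ-divides 1≤h h≤g h∣g = ∈⇒∣ₚ∏ (∈-map⁺ Φ (∈-properDivisors⁺ 1≤h (ℕP.≤-<-trans h≤g g<m) (ℕD.∣-trans h∣g g∣m)))
    product∣ : ∏ₚ (map Φ (g ∷ properDivisors g)) ∣ₚ Φ-proper m
    product∣ = ∏ₚ-∣ₚ
      (All.map⁺ {xs = g ∷ properDivisors g} (monic (ih g<m 1≤g) ∷ All.map monic (proper-cyclotomic g≤m 1≤g)))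
      (AllPairs.map⁺ {xs = g ∷ properDivisors g}
        (All.tabulate (λ e∈ → let 1≤e , e<g , _ = ∈-properDivisors⁻ 1≤g e∈ in coprime (ih g<m 1≤g) 1≤e e<g)
          ∷ proper-coprime g≤m 1≤g))
      (All.map⁺ {xs = g ∷ properDivisors g} (Φ-divides 1≤g ℕP.≤-refl ℕD.∣-refl ∷
        All.tabulate λ e∈ → let 1≤e , e<g , e∣g = ∈-properDivisors⁻ 1≤g e∈ in Φ-divides 1≤e (ℕP.<⇒≤ e<g) e∣g))
    C = cofactor product∣
    e = factorisation product∣

  -- With g = gcd m f, the cofactor (X^m − 1)/(X^g − 1) is a multiple of Φ_m and is m/g modulo X^g − 1,
  -- which itself lies in the ideal (Φ_m, Φ_f).
  Φ-coprime : ∀ {f} → 1 ≤ f → f < m → CoprimeOverℚ (Φ m) (Φ f)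
  Φ-coprime {f} 1≤f f<m with gcd[m,n]∣m m f
  ... | ℕD.divides k m≡kg = bézout k≢0 A B (begin
    const (+ k)                   ≈⟨ +-identityʳ (const (+ k)) ⟨
    const (+ k) - 0#              ≈⟨ difference ⟩
    Φ m * A + Φ f * B             ∎)
    where
    open ℤ[X]
    open Quotient polyAlgebra (Φ m) (Φ f)
    module Q = AlgebraTheory quotient
    g = gcd m f
    instance
      f≢0 : NonZero f
      f≢0 = >-nonZero 1≤f
      g≢0 : NonZero g
      g≢0 = ≢-nonZero (gcd[m,n]≢0 m f (inj₂ (ℕP.m<n⇒n≢0 1≤f)))
    1≤g : 1 ≤ g
    1≤g = ℕ.>-nonZero⁻¹ g
    g<m : g < m
    g<m = ℕP.≤-<-trans (ℕD.∣⇒≤ (gcd[m,n]∣n m f)) f<m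
    k≢0 : + k ≢ 0ℤ
    k≢0 refl = ℕP.m<n⇒n≢0 1≤m m≡kg
    U = geometric k (X^ g)
    C = cofactor (unity∣Φ-proper 1≤g g<m (gcd[m,n]∣m m f))
    -- The monic factor X^g - 1 is cancelled from (X^g - 1)·U = X^m - 1 = Φ_m·(X^g - 1)·C.
    U≈Φ*C : U ≈ Φ m * C
    U≈Φ*C = *ₚ-cancelˡ (g , unity-Lead g 1≤g) (begin
      unity g * U            ≈⟨ unity-factor g k ⟨
      unity (g ℕ.* k)        ≡⟨ cong unity (≡.trans (ℕP.*-comm g k) (≡.sym m≡kg)) ⟩
      unity m                ≈⟨ Φ-factorisation ⟩
      Φ m * Φ-proper m       ≈⟨ *-congˡ {Φ m} (factorisation (unity∣Φ-proper 1≤g g<m (gcd[m,n]∣m m f))) ⟩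
      Φ m * (unity g * C)    ≈⟨ solve 3 (λ p y c → p :* (y :* c) := y :* (p :* c)) ≈-refl (Φ m) (unity g) C ⟩
      unity g * (Φ m * C)    ∎)
    root-of-unity : ∀ {n} → unity n ~ 0# → X^ 1 Q.^ n ~ 1#
    root-of-unity {n} z = ~-trans (≈⇒~ (≡.subst (_≈ X^ n) (^-quotient (X^ 1) n) (≈-sym (X^-power n)))) (Q.x-1≈0⇒x≈1 z)
    -- Φ_m divides X^m - 1 and Φ_f divides X^f - 1, so X has both periods m and f in the quotient,
    -- hence also their gcd.
    X^g~1 : X^ g ~ 1#
    X^g~1 = ~-trans (≈⇒~ (≡.subst (X^ g ≈_) (^-quotient (X^ 1) g) (X^-power g)))
      (Q.^-gcd (Bézout.identity (gcd-GCD m f))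
        (root-of-unity (~-trans (≈⇒~ Φ-factorisation) (generator₁~0 _)))
        (root-of-unity (~-trans (≈⇒~ (unity-product (ih f<m 1≤f))) (generator₂~0 _))))
    k~0 : const (+ k) ~ 0#
    k~0 = Q.≈-trans (Q.≈-sym (Q.geometric-at-1 k X^g~1))
      (≡.subst (_~ 0#) (geometric-quotient k (X^ g)) (~-trans (≈⇒~ U≈Φ*C) (generator₁~0 C)))
    open _~_ k~0 renaming (cofactor₁ to A; cofactor₂ to B)

cyclotomic : ∀ m → 1 ≤ m → Cyclotomic m
cyclotomic = <-rec (λ m → 1 ≤ m → Cyclotomic m) λ m ih 1≤m →
  let open CyclotomicStep m 1≤m ih in
  record { positive = 1≤m ; monic = Φ-monic ; unity-product = Φ-factorisation ; coprime = Φ-coprime }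

-- Polynomials modulo p and Fermat's little theorem

eval : Poly → ℤ → ℤ
eval []      x = 0ℤ
eval (a ∷ P) x = a ℤ.+ x ℤ.* eval P x

-- The quotient of a ∷ P by X − c; it does not depend on a.
synthetic : ℤ → Poly → Poly
synthetic c []      = []
synthetic c (b ∷ P) = eval (b ∷ P) c ∷ synthetic c P

length-synthetic : ∀ c P → length (synthetic c P) ≡ length P
length-synthetic c []      = refl
length-synthetic c (b ∷ P) = cong suc (length-synthetic c P)

-- The remainder theorem. The signs are arranged to expose c - x, the form in which distinctness of
-- roots is supplied.
synthetic-spec : ∀ a P x c → eval (a ∷ P) x ≡ eval (a ∷ P) c ℤ.+ (c ℤ.- x) ℤ.* (ℤ.- eval (synthetic c P) x)
synthetic-spec a []      x c = constant a x c
  where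
  constant : ∀ a x c → a ℤ.+ x ℤ.* 0ℤ ≡ (a ℤ.+ c ℤ.* 0ℤ) ℤ.+ (c ℤ.- x) ℤ.* (ℤ.- 0ℤ)
  constant = solve-∀
synthetic-spec a (b ∷ P) x c = ≡.trans (cong (λ v → a ℤ.+ x ℤ.* v) (synthetic-spec b P x c))
  (step a x c (eval (b ∷ P) c) (eval (synthetic c P) x))
  where
  step : ∀ a x c u v → a ℤ.+ x ℤ.* (u ℤ.+ (c ℤ.- x) ℤ.* (ℤ.- v))
                     ≡ (a ℤ.+ c ℤ.* u) ℤ.+ (c ℤ.- x) ℤ.* (ℤ.- (u ℤ.+ x ℤ.* v))
  step = solve-∀

-- The entries of `synthetic` are the values at c of the successive tails, and each coefficient is
-- the value of its own tail minus c times the value of the next.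
∣-synthetic⇒∣ : ∀ {p c} a P → p ∣ℤ eval (a ∷ P) c → All (p ∣ℤ_) (synthetic c P) → All (p ∣ℤ_) (a ∷ P)
∣-synthetic⇒∣ {c = c} a []      p∣e []         = ℤD.∣m+n∣n⇒∣m p∣e (ℤD.∣n⇒∣m*n c (ℤD.divides 0ℤ refl)) ∷ []
∣-synthetic⇒∣ {c = c} a (b ∷ P) p∣e (p∣e′ ∷ p∣Q) = ℤD.∣m+n∣n⇒∣m p∣e (ℤD.∣n⇒∣m*n c p∣e′) ∷ ∣-synthetic⇒∣ b P p∣e′ p∣Q

euclid-ℤ : ∀ {p} → Prime p → ∀ x y → + p ∣ℤ x ℤ.* y → + p ∣ℤ x ⊎ + p ∣ℤ y
euclid-ℤ {p} p-prime x y p∣xy with euclidsLemma ℤ.∣ x ∣ ℤ.∣ y ∣ p-prime (≡.subst (p ∣_) (ℤ.abs-* x y) (∣⇒∣ᵤ p∣xy))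
... | inj₁ p∣x = inj₁ (∣ᵤ⇒∣ p∣x)
... | inj₂ p∣y = inj₂ (∣ᵤ⇒∣ p∣y)

-- Lagrange's bound on the number of roots: dividing out one root leaves the others as roots of the
-- quotient because p is prime. List length stands for degree plus one.
vanishing-poly : ∀ {p} → Prime p → ∀ P xs → length P ≤ length xs →
  AllPairs (λ x y → ¬ (+ p ∣ℤ x ℤ.- y)) xs → All (λ x → + p ∣ℤ eval P x) xs → All (+ p ∣ℤ_) P
vanishing-poly p-prime []      xs       _         _                _           = []
vanishing-poly p-prime (a ∷ P) (c ∷ xs) (s≤s |P|≤) (distinct ∷ ds) (root ∷ roots) =
  ∣-synthetic⇒∣ a P root (vanishing-poly p-prime (synthetic c P) xs
    (≡.subst (_≤ length xs) (≡.sym (length-synthetic c P)) |P|≤) ds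
    (All.zipWith root-of-quotient (distinct , roots)))
  where
  root-of-quotient : ∀ {x} → ¬ (_ ∣ℤ c ℤ.- x) × _ ∣ℤ eval (a ∷ P) x → _ ∣ℤ eval (synthetic c P) x
  root-of-quotient {x} (p∤c-x , p∣e)
    with euclid-ℤ p-prime (c ℤ.- x) (ℤ.- eval (synthetic c P) x) (ℤD.∣m+n∣m⇒∣n (≡.subst (_ ∣ℤ_) (synthetic-spec a P x c) p∣e) root)
  ... | inj₁ p∣c-x = ⊥-elim (p∤c-x p∣c-x)
  ... | inj₂ p∣-q  = ≡.subst (_ ∣ℤ_) (ℤ.neg-involutive _) (ℤD.∣m⇒∣-m p∣-q)

residues-distinct : ∀ p → AllPairs (λ x y → ¬ (+ p ∣ℤ x ℤ.- y)) (map +_ (upTo p))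
residues-distinct p = AllPairs.map⁺ (AllPairs.applyUpTo⁺₁ (λ i → i) p distinct)
  where
  distinct : ∀ {i j} → i < j → j < p → ¬ (+ p ∣ℤ + i ℤ.- + j)
  distinct {i} {j} i<j j<p p∣i-j =
    ℕP.<⇒≱ j<p (ℕP.≤-trans (ℕD.∣⇒≤ {{>-nonZero (ℕP.m<n⇒0<n∸m i<j)}} p∣j-i) (ℕP.m∸n≤m j i))
    where
    p∣j-i : p ∣ j ∸ i
    p∣j-i = ≡.subst (p ∣_) (≡.trans (cong ℤ.∣_∣ (ℤ.m-n≡m⊖n i j))
      (≡.trans (ℤ.∣⊖∣-< i<j) refl)) (∣⇒∣ᵤ p∣i-j)

prime∤! : ∀ {p} → Prime p → ∀ {j} → j < p → ¬ (p ∣ j !)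
prime∤! p-prime {zero}  _   p∣1 = ¬prime[1] (≡.subst Prime (ℕD.∣1⇒≡1 p∣1) p-prime)
prime∤! {p} p-prime {suc j} j<p p∣! with euclidsLemma (suc j) (j !) p-prime p∣!
... | inj₁ p∣1+j = ℕP.<⇒≱ j<p (ℕD.∣⇒≤ p∣1+j)
... | inj₂ p∣j!  = prime∤! p-prime (ℕP.<-trans (ℕP.n<1+n j) j<p) p∣j!

-- p divides p! = C(p,k)·k!·(p-k)!, but by `prime∤!` neither of the two factorials.
prime∣choose : ∀ {p} → Prime p → ∀ {k} → 0 < k → k < p → p ∣ p choose k
prime∣choose {p} p-prime {k} 0<k k<p with euclidsLemma (p choose k) (k ! ℕ.* (p ∸ k) !) p-prime p∣C*k!*[p∸k]!
  where
  instance
    _ = prime⇒nonZero p-prime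
    _ = ℕP.m*n≢0 (k !) ((p ∸ k) !) {{k ℕP.!≢0}} {{(p ∸ k) ℕP.!≢0}}
  p∣C*k!*[p∸k]! : p ∣ (p choose k) ℕ.* (k ! ℕ.* (p ∸ k) !)
  p∣C*k!*[p∸k]! = ≡.subst (p ∣_) (≡.sym (≡.trans (cong (ℕ._* (k ! ℕ.* (p ∸ k) !)) (nCk≡n!/k![n-k]! (ℕP.<⇒≤ k<p)))
    (m/n*n≡m (k![n∸k]!∣n! (ℕP.<⇒≤ k<p))))) (n∣n! p)
    where
    n∣n! : ∀ n → .{{NonZero n}} → n ∣ n !
    n∣n! (suc n) = ℕD.m∣m*n (n !)
... | inj₁ p∣C = p∣C
... | inj₂ p∣k!*[p∸k]! with euclidsLemma (k !) ((p ∸ k) !) p-prime p∣k!*[p∸k]!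
...   | inj₁ p∣k!     = ⊥-elim (prime∤! p-prime k<p p∣k!)
...   | inj₂ p∣[p∸k]! = ⊥-elim (prime∤! p-prime (ℕP.∸-monoʳ-< 0<k (ℕP.<⇒≤ k<p)) p∣[p∸k]!)

module Characteristic (𝓐 : ℤ-Algebra) (p : ℕ) (p-prime : Prime p)
  (p≈0 : CommutativeRing._≈_ (ℤ-Algebra.commutativeRing 𝓐) (AlgebraTheory.ι 𝓐 (+ p)) (CommutativeRing.0# (ℤ-Algebra.commutativeRing 𝓐))) where

  open AlgebraTheory 𝓐
  open Binomial commutativeSemiring
  open import Algebra.Properties.Semiring.Sum semiring using (sum; sum-cong-≋; sum-replicate-zero; sum-init-last)
  open import Algebra.Properties.Semiring.Mult semiring using () renaming (_×_ to _×ᵣ_)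

  ∣⇒≈0 : ∀ {a} → + p ∣ℤ a → ι a ≈ 0#
  ∣⇒≈0 (ℤD.divides q refl) = ≈-trans (ι-* q (+ p)) (≈-trans (*-congˡ p≈0) (zeroʳ _))

  ×≈ι* : ∀ n x → n ×ᵣ x ≈ ι (+ n) * x
  ×≈ι* zero    x = ≈-sym (≈-trans (*-congʳ ι-0) (zeroˡ x))
  ×≈ι* (suc n) x = begin
    x + n ×ᵣ x                ≈⟨ +-cong (≈-sym (*-identityˡ x)) (×≈ι* n x) ⟩
    1# * x + ι (+ n) * x      ≈⟨ distribʳ x 1# (ι (+ n)) ⟨
    (1# + ι (+ n)) * x        ≈⟨ *-congʳ (+-congʳ ι-1) ⟨
    (ι 1ℤ + ι (+ n)) * x      ≈⟨ *-congʳ (ι-+ 1ℤ (+ n)) ⟨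
    ι (+ suc n) * x           ∎

  -- In the binomial expansion the inner coefficients are multiples of p, so only the two outer
  -- terms survive.
  frobenius : ∀ x → (x + 1#) ^ p ≈ x ^ p + 1#
  frobenius x = ≡.subst (λ n → (x + 1#) ^ n ≈ x ^ n + 1#) (≡.sym p≡) (begin
    (x + 1#) ^ suc p′                               ≈⟨ theorem (suc p′) x 1# ⟩
    term Fin.zero + sum (λ i → term (Fin.suc i))    ≈⟨ +-congˡ (sum-init-last (λ i → term (Fin.suc i))) ⟩
    term Fin.zero + (sum (λ i → term (Fin.suc (inject₁ i))) + term (Fin.suc (fromℕ p′)))
      ≈⟨ +-cong first (+-cong (≈-trans (sum-cong-≋ middle) (sum-replicate-zero p′)) last) ⟩
    1# + (0# + x ^ suc p′)                          ≈⟨ +-congˡ (+-identityˡ _) ⟩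
    1# + x ^ suc p′                                 ≈⟨ +-comm 1# _ ⟩
    x ^ suc p′ + 1#                                 ∎)
    where
    p′ = ℕ.pred p
    p≡ : p ≡ suc p′
    p≡ = ≡.sym (ℕP.suc-pred p {{prime⇒nonZero p-prime}})
    term = binomialTerm x 1# (suc p′)
    first : term Fin.zero ≈ 1#
    first = ≈-trans (+-identityʳ _) (≈-trans (*-identityˡ _) (1^n≈1 (suc p′)))
    middle : ∀ i → term (Fin.suc (inject₁ i)) ≈ 0#
    middle i = ≈-trans (×≈ι* (suc p′ choose toℕ k) _) (≈-trans (*-congʳ (∣⇒≈0 (∣ᵤ⇒∣ p∣C))) (zeroˡ _))
      where
      k = Fin.suc (inject₁ i)
      p∣C : p ∣ suc p′ choose toℕ k
      p∣C = ≡.subst (λ n → p ∣ n choose toℕ k) p≡ (prime∣choose p-prime (s≤s z≤n)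
        (≡.subst (toℕ k <_) (≡.sym p≡) (s≤s (≡.subst (_< p′) (≡.sym (Fin.toℕ-inject₁ i)) (Fin.toℕ<n i)))))
    last : term (Fin.suc (fromℕ p′)) ≈ x ^ suc p′
    last rewrite Fin.toℕ-fromℕ p′ | nCn≡1 (suc p′) | ℕP.n∸n≡0 p′ = ≈-trans (+-identityʳ _) (*-identityʳ _)

  fermat : ∀ n → ι (+ n) ^ p ≈ ι (+ n)
  fermat zero    = ≈-trans (^-congˡ p ι-0) (≈-trans (0^p≈0 p {{prime⇒nonZero p-prime}}) (≈-sym ι-0))
    where
    0^p≈0 : ∀ n → .{{NonZero n}} → 0# ^ n ≈ 0#
    0^p≈0 (suc n) = zeroˡ _
  fermat (suc n) = begin
    ι (+ suc n) ^ p        ≈⟨ ^-congˡ p ι-suc ⟩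
    (ι (+ n) + 1#) ^ p     ≈⟨ frobenius (ι (+ n)) ⟩
    ι (+ n) ^ p + 1#       ≈⟨ +-congʳ (fermat n) ⟩
    ι (+ n) + 1#           ≈⟨ ι-suc ⟨
    ι (+ suc n)            ∎
    where
    ι-suc : ι (+ suc n) ≈ ι (+ n) + 1#
    ι-suc = ≈-trans (ι-+ 1ℤ (+ n)) (≈-trans (+-congʳ ι-1) (+-comm 1# _))

-- Exponents modulo p − 1

module Modular (m : ℕ) where
  open Quotient intAlgebra (+ m) 0ℤ public

  ∣⇒~ : ∀ {x y} → + m ∣ℤ x ℤ.- y → x ~ y
  ∣⇒~ (ℤD.divides q eq) = modulo q 0ℤ (≡.trans eq (≡.trans (ℤ.*-comm q (+ m)) (≡.sym (ℤ.+-identityʳ _))))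

  ~⇒∣ : ∀ {x y} → x ~ y → + m ∣ℤ x ℤ.- y
  ~⇒∣ (modulo A B eq) = ℤD.divides A (≡.trans eq (≡.trans (ℤ.+-identityʳ _) (ℤ.*-comm (+ m) A)))

  ~0⇒∣ : ∀ {x} → x ~ 0ℤ → + m ∣ℤ x
  ~0⇒∣ {x} e = ≡.subst (+ m ∣ℤ_) (ℤ.+-identityʳ x) (~⇒∣ e)

  ∣⇒~0 : ∀ {x} → + m ∣ℤ x → x ~ 0ℤ
  ∣⇒~0 {x} e = ∣⇒~ (≡.subst (+ m ∣ℤ_) (≡.sym (ℤ.+-identityʳ x)) e)

  module ℤ/m = AlgebraTheory quotient

  characteristic : + m ~ 0ℤ
  characteristic = ∣⇒~0 ℤD.∣-refl

  ^-~ : ∀ x n → x ℤ.^ n ~ x ℤ/m.^ n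
  ^-~ x n = ≈⇒~ (power n)
    where
    power : ∀ n → x ℤ.^ n ≡ x ℤ/m.^ n
    power zero    = refl
    power (suc n) = cong (x ℤ.*_) (power n)

∈-divisors⁻ : ∀ {e n} → e ∈ divisors n → 1 ≤ e × e ∣ n
∈-divisors⁻ {n = n} e∈ with ∈-filter⁻ (_∣? n) {xs = range1 n} e∈
... | e∈range , e∣n = proj₁ (∈-range1⁻ {n = n} e∈range) , e∣n

∈-divisors⁺ : ∀ {e n} → 1 ≤ n → 1 ≤ e → e ∣ n → e ∈ divisors n
∈-divisors⁺ {n = suc n} _ 1≤e e∣n = ∈-filter⁺ (_∣? suc n) (∈-range1⁺ 1≤e (ℕD.∣⇒≤ e∣n)) e∣n

eval-+ₚ : ∀ P Q x → eval (P +ₚ Q) x ≡ eval P x ℤ.+ eval Q x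
eval-+ₚ []      Q       x = ≡.sym (ℤ.+-identityˡ _)
eval-+ₚ (a ∷ P) []      x = ≡.sym (ℤ.+-identityʳ _)
eval-+ₚ (a ∷ P) (b ∷ Q) x = ≡.trans (cong (λ v → a ℤ.+ b ℤ.+ x ℤ.* v) (eval-+ₚ P Q x)) (rearrange a b x _ _)
  where
  rearrange : ∀ a b x u v → a ℤ.+ b ℤ.+ x ℤ.* (u ℤ.+ v) ≡ (a ℤ.+ x ℤ.* u) ℤ.+ (b ℤ.+ x ℤ.* v)
  rearrange = solve-∀

eval-X^ : ∀ k x → eval (X^ k) x ≡ x ℤ.^ k
eval-X^ zero    x = ≡.trans (cong (ℤ._+_ 1ℤ) (ℤ.*-zeroʳ x)) refl
eval-X^ (suc k) x = ≡.trans (ℤ.+-identityˡ _) (cong (x ℤ.*_) (eval-X^ k x))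

length-+ₚ : ∀ {P Q n} → length P ≤ n → length Q ≤ n → length (P +ₚ Q) ≤ n
length-+ₚ {[]}             _         |Q|≤n     = |Q|≤n
length-+ₚ {a ∷ P} {[]}     |P|≤n     _         = |P|≤n
length-+ₚ {a ∷ P} {b ∷ Q}  (s≤s |P|≤n) (s≤s |Q|≤n) = s≤s (length-+ₚ {P} {Q} |P|≤n |Q|≤n)

length-X^ : ∀ k → length (X^ k) ≡ suc k
length-X^ zero    = refl
length-X^ (suc k) = cong suc (length-X^ k)

module ReducedExponents (p : ℕ) (p-prime : Prime p) where

  open Modular p hiding (_~_)
  open Modular p using (_~_)

  instance
    p∸1≢0 : NonZero (p ∸ 1)
    p∸1≢0 = >-nonZero (ℕP.m<n⇒0<n∸m (ℕ.nonTrivial⇒n>1 p {{prime⇒nonTrivial p-prime}}))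

  p≡1+[p∸1] : p ≡ suc (p ∸ 1)
  p≡1+[p∸1] = ≡.sym (ℕP.m+[n∸m]≡n (ℕ.>-nonZero⁻¹ p {{prime⇒nonZero p-prime}}))

  -- Exponents land in 1 ... p-1 and not in 0 ... p-2, because x^p = x holds for every residue while
  -- x^(p-1) = 1 fails at 0.
  reduce : ℕ → ℕ
  reduce e = suc ((e ∸ 1) % (p ∸ 1))

  reduce<p : ∀ e → reduce e < p
  reduce<p e = ≡.subst (reduce e <_) (≡.sym p≡1+[p∸1]) (s≤s (m%n<n (e ∸ 1) (p ∸ 1)))

  fermat-reduce : ∀ i e → 1 ≤ e → (+ i) ℤ.^ reduce e ~ (+ i) ℤ.^ e
  fermat-reduce i (suc e) _ = begin
    (+ i) ℤ.^ suc (e % N)                    ≈⟨ ^-~ (+ i) (suc (e % N)) ⟩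
    (+ i) ^ suc (e % N)                      ≈⟨ add-periods (e / N) ⟨
    (+ i) ^ suc (e % N ℕ.+ e / N ℕ.* N)      ≡⟨ cong (λ k → (+ i) ^ suc k) (m≡m%n+[m/n]*n e N) ⟨
    (+ i) ^ suc e                            ≈⟨ ^-~ (+ i) (suc e) ⟨
    (+ i) ℤ.^ suc e                          ∎
    where
    open ℤ/m
    N = p ∸ 1
    r = e % N
    open Characteristic quotient p p-prime characteristic using (fermat)
    add-periods : ∀ k → (+ i) ^ suc (r ℕ.+ k ℕ.* N) ≈ (+ i) ^ suc r
    add-periods zero    = ^-congʳ (+ i) (cong suc (ℕP.+-identityʳ r))
    -- One period is split off as p factors, which Fermat replaces by a single one; the leading
    -- `suc` guarantees that enough factors are present.
    add-periods (suc k) = begin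
      (+ i) ^ suc (r ℕ.+ (N ℕ.+ k ℕ.* N))      ≡⟨ cong ((+ i) ^_) exponent ⟩
      (+ i) ^ (p ℕ.+ (r ℕ.+ k ℕ.* N))          ≈⟨ ^-homo-* (+ i) p _ ⟩
      (+ i) ^ p * (+ i) ^ (r ℕ.+ k ℕ.* N)      ≈⟨ *-congʳ (fermat i) ⟩
      (+ i) ^ suc (r ℕ.+ k ℕ.* N)              ≈⟨ add-periods k ⟩
      (+ i) ^ suc r                            ∎
      where
      exponent : suc (r ℕ.+ (N ℕ.+ k ℕ.* N)) ≡ p ℕ.+ (r ℕ.+ k ℕ.* N)
      exponent = ≡.trans (cong suc (≡.trans (≡.sym (ℕP.+-assoc r N (k ℕ.* N))) (≡.trans (cong (ℕ._+ k ℕ.* N) (ℕP.+-comm r N)) (ℕP.+-assoc N r (k ℕ.* N)))))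
        (cong (ℕ._+ (r ℕ.+ k ℕ.* N)) (≡.sym p≡1+[p∸1]))

  -- The seed `0ℤ ∷ c ∷ []` is the linear term c·X. It is kept general because d(n) must not change
  -- while the list of divisors shrinks in inductions.
  reducedSum : ℤ → List ℕ → Poly
  reducedSum c = foldr (λ e P → X^ (reduce e) +ₚ P) (0ℤ ∷ c ∷ [])

  -- T_n with its exponents reduced modulo x^p − x.
  reducedT : ℕ → Poly
  reducedT n = reducedSum (ℤ.- (+ d n)) (divisors n)

  length-reducedSum : ∀ c es → length (reducedSum c es) ≤ p
  length-reducedSum c []       = ℕ.nonTrivial⇒n>1 p {{prime⇒nonTrivial p-prime}}
  length-reducedSum c (e ∷ es) = length-+ₚ {X^ (reduce e)} {reducedSum c es}
    (≡.subst (_≤ p) (≡.sym (length-X^ (reduce e))) (reduce<p e)) (length-reducedSum c es)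

  eval-reducedSum : ∀ c i {es} → All (1 ≤_) es →
    eval (reducedSum c es) (+ i) ~ foldr (λ e acc → ((+ i) ℤ.^ e) ℤ.+ acc) 0ℤ es ℤ.+ c ℤ.* + i
  eval-reducedSum c i []                = ≈⇒~ (base c (+ i))
    where
    base : ∀ c x → 0ℤ ℤ.+ x ℤ.* (c ℤ.+ x ℤ.* 0ℤ) ≡ 0ℤ ℤ.+ c ℤ.* x
    base = solve-∀
  eval-reducedSum c i {e ∷ es} (1≤e ∷ 1≤es) = begin
    eval (X^ (reduce e) +ₚ reducedSum c es) (+ i)          ≡⟨ eval-+ₚ (X^ (reduce e)) (reducedSum c es) (+ i) ⟩
    eval (X^ (reduce e)) (+ i) + eval (reducedSum c es) (+ i) ≡⟨ cong (_+ eval (reducedSum c es) (+ i)) (eval-X^ (reduce e) (+ i)) ⟩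
    (+ i) ℤ.^ reduce e + eval (reducedSum c es) (+ i)      ≈⟨ +-cong (fermat-reduce i e 1≤e) (eval-reducedSum c i 1≤es) ⟩
    (+ i) ℤ.^ e + (Σx^e + c ℤ.* + i)                       ≈⟨ +-assoc ((+ i) ℤ.^ e) Σx^e (c ℤ.* + i) ⟨
    (+ i) ℤ.^ e + Σx^e + c ℤ.* + i                         ∎
    where
    open ℤ/m
    Σx^e = foldr (λ e acc → ((+ i) ℤ.^ e) ℤ.+ acc) 0ℤ es

  ∣-reducedT : ∀ {n} → WeaklyAlmostPrime n → p ∣ n → All (+ p ∣ℤ_) (reducedT n)
  ∣-reducedT {n} (1≤n , n∣T) p∣n = vanishing-poly p-prime (reducedT n) (map +_ (upTo p))
    (≡.subst (length (reducedT n) ≤_) (≡.sym (≡.trans (List.length-map +_ (upTo p)) (List.length-upTo p))) (length-reducedSum _ (divisors n)))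
    (residues-distinct p)
    (All.map⁺ (All.tabulate λ {i} _ → ~0⇒∣ (ℤ/m.≈-trans
      (eval-reducedSum _ i (All.tabulate λ e∈ → proj₁ (∈-divisors⁻ {n = n} e∈)))
      (ℤ/m.≈-trans (≈⇒~ (cong (ℤ._+_ (Σx^d (+ i))) (≡.sym (ℤ.neg-distribˡ-* (+ d n) (+ i))))) (∣⇒~0 (p∣T i))))))
    where
    Σx^d : ℤ → ℤ
    Σx^d x = foldr (λ e acc → (x ℤ.^ e) ℤ.+ acc) 0ℤ (divisors n)
    p∣T : ∀ i → + p ∣ℤ T n (+ i)
    p∣T i = ∣ᵤ⇒∣ (ℕD.∣-trans p∣n (n∣T (+ i)))

  module LinearExtension (𝓐 : ℤ-Algebra)
    (p≈0 : CommutativeRing._≈_ (ℤ-Algebra.commutativeRing 𝓐) (AlgebraTheory.ι 𝓐 (+ p)) (CommutativeRing.0# (ℤ-Algebra.commutativeRing 𝓐))) where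

    open AlgebraTheory 𝓐
    open ListSums 𝓐
    open Characteristic 𝓐 p p-prime p≈0 using (∣⇒≈0)

    -- The ℤ-linear map sending X^k to h k.
    Λ : (ℕ → Carrier) → Poly → Carrier
    Λ h []      = 0#
    Λ h (a ∷ P) = ι a * h 0 + Λ (h ∘ suc) P

    Λ-+ₚ : ∀ h P Q → Λ h (P +ₚ Q) ≈ Λ h P + Λ h Q
    Λ-+ₚ h []      Q       = ≈-sym (+-identityˡ _)
    Λ-+ₚ h (a ∷ P) []      = ≈-sym (+-identityʳ _)
    Λ-+ₚ h (a ∷ P) (b ∷ Q) = begin
      ι (a ℤ.+ b) * h 0 + Λ (h ∘ suc) (P +ₚ Q)          ≈⟨ +-cong (*-congʳ (ι-+ a b)) (Λ-+ₚ (h ∘ suc) P Q) ⟩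
      (ι a + ι b) * h 0 + (Λ (h ∘ suc) P + Λ (h ∘ suc) Q)
        ≈⟨ solve 5 (λ a b h u v → (a :+ b) :* h :+ (u :+ v) := (a :* h :+ u) :+ (b :* h :+ v)) ≈-refl (ι a) (ι b) (h 0) (Λ (h ∘ suc) P) (Λ (h ∘ suc) Q) ⟩
      (ι a * h 0 + Λ (h ∘ suc) P) + (ι b * h 0 + Λ (h ∘ suc) Q) ∎

    Λ-0∷ : ∀ h P → Λ h (0ℤ ∷ P) ≈ Λ (h ∘ suc) P
    Λ-0∷ h P = ≈-trans (+-congʳ (≈-trans (*-congʳ ι-0) (zeroˡ _))) (+-identityˡ _)

    Λ-X^ : ∀ h k → Λ h (X^ k) ≈ h k
    Λ-X^ h zero    = ≈-trans (+-identityʳ _) (≈-trans (*-congʳ ι-1) (*-identityˡ _))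
    Λ-X^ h (suc k) = ≈-trans (Λ-0∷ h (X^ k)) (Λ-X^ (h ∘ suc) k)

    Λ-∣ : ∀ h {P} → All (+ p ∣ℤ_) P → Λ h P ≈ 0#
    Λ-∣ h []           = ≈-refl
    Λ-∣ h (p∣a ∷ p∣P) = ≈-trans (+-cong (≈-trans (*-congʳ (∣⇒≈0 p∣a)) (zeroˡ _)) (Λ-∣ (h ∘ suc) p∣P)) (+-identityˡ 0#)

    Λ-reducedSum : ∀ h c es → Λ h (reducedSum c es) ≈ Σᴸ (h ∘ reduce) es + ι c * h 1
    Λ-reducedSum h c []       = ≈-trans (Λ-0∷ h (c ∷ [])) (+-comm (ι c * h 1) 0#)
    Λ-reducedSum h c (e ∷ es) = begin
      Λ h (X^ (reduce e) +ₚ reducedSum c es)            ≈⟨ Λ-+ₚ h (X^ (reduce e)) (reducedSum c es) ⟩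
      Λ h (X^ (reduce e)) + Λ h (reducedSum c es)       ≈⟨ +-cong (Λ-X^ h (reduce e)) (Λ-reducedSum h c es) ⟩
      h (reduce e) + (Σᴸ (h ∘ reduce) es + ι c * h 1)   ≈⟨ +-assoc _ _ _ ⟨
      h (reduce e) + Σᴸ (h ∘ reduce) es + ι c * h 1     ∎

    Σᴸ-reduce : ∀ h → (∀ e → 1 ≤ e → h (reduce e) ≈ h e) → ∀ {es} → All (1 ≤_) es → Σᴸ (h ∘ reduce) es ≈ Σᴸ h es
    Σᴸ-reduce h periodic []           = ≈-refl
    Σᴸ-reduce h periodic (1≤e ∷ 1≤es) = +-cong (periodic _ 1≤e) (Σᴸ-reduce h periodic 1≤es)

    periodic-divisor-sum : ∀ {n} → WeaklyAlmostPrime n → p ∣ n →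
      ∀ h → (∀ e → 1 ≤ e → h (reduce e) ≈ h e) → Σᴸ h (divisors n) ≈ ι (+ d n) * h 1
    periodic-divisor-sum {n} weaklyAlmostPrime p∣n h periodic = x-y≈0⇒x≈y _ _ (begin
      Σᴸ h (divisors n) - ι (+ d n) * h 1
        ≈⟨ solve 3 (λ s c h → s :- c :* h := s :+ (:- c) :* h) ≈-refl (Σᴸ h (divisors n)) (ι (+ d n)) (h 1) ⟩
      Σᴸ h (divisors n) + - ι (+ d n) * h 1
        ≈⟨ +-cong (Σᴸ-reduce h periodic (All.tabulate λ e∈ → proj₁ (∈-divisors⁻ {n = n} e∈))) (*-congʳ (ι-neg (+ d n))) ⟨
      Σᴸ (h ∘ reduce) (divisors n) + ι (ℤ.- (+ d n)) * h 1
        ≈⟨ Λ-reducedSum h (ℤ.- (+ d n)) (divisors n) ⟨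
      Λ h (reducedT n)
        ≈⟨ Λ-∣ h (∣-reducedT weaklyAlmostPrime p∣n) ⟩
      0# ∎)

-- Primitive roots and characters

∣difference∣ : ∀ {a b} → a ≤ b → ℤ.∣ + a ℤ.- + b ∣ ≡ b ∸ a
∣difference∣ {a} {b} a≤b = ≡.trans (cong ℤ.∣_∣ (ℤ.m-n≡m⊖n a b)) (ℤ.∣⊖∣-≤ a≤b)

module Congruence (n : ℕ) where
  open Modular n

  ~⇒∣∸ : ∀ {a b} → a ≤ b → + a ~ + b → n ∣ b ∸ a
  ~⇒∣∸ a≤b e = ≡.subst (n ∣_) (∣difference∣ a≤b) (∣⇒∣ᵤ (~⇒∣ e))

  ∣∸⇒~ : ∀ {a b} → a ≤ b → n ∣ b ∸ a → + a ~ + b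
  ∣∸⇒~ a≤b n∣ = ∣⇒~ (∣ᵤ⇒∣ (≡.subst (n ∣_) (≡.sym (∣difference∣ a≤b)) n∣))

  <⇒≁ : ∀ {a b} → 1 ≤ a → a < b → b ≤ n → ¬ (+ a ~ + b)
  <⇒≁ {a} {b} 1≤a a<b b≤n e = ℕP.<⇒≱ (ℕP.<-≤-trans (ℕP.∸-monoʳ-< 1≤a (ℕP.<⇒≤ a<b)) b≤n)
    (ℕD.∣⇒≤ {{>-nonZero (ℕP.m<n⇒0<n∸m a<b)}} (~⇒∣∸ (ℕP.<⇒≤ a<b) e))

  representative-unique : ∀ {a b} → 1 ≤ a → a ≤ n → 1 ≤ b → b ≤ n → + a ~ + b → a ≡ b
  representative-unique {a} {b} 1≤a a≤n 1≤b b≤n e with ℕP.<-cmp a b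
  ... | tri< a<b _ _ = ⊥-elim (<⇒≁ 1≤a a<b b≤n e)
  ... | tri≈ _ a≡b _ = a≡b
  ... | tri> _ _ b<a = ⊥-elim (<⇒≁ 1≤b b<a a≤n (~-sym e))

  -- Representatives lie in 1 ... n to match `range1`; adding n - 1 before reducing stands for a - 1
  -- modulo n, also when a = 0.
  representative : 1 ≤ n → ∀ a → ∃[ b ] 1 ≤ b × b ≤ n × + b ~ + a
  representative 1≤n a = suc r , s≤s z≤n , m%n<n (a ℕ.+ (n ∸ 1)) n ,
    ~-trans (∣∸⇒~ r≤ (ℕD.divides q (≡.trans (cong (_∸ suc r) total) (ℕP.m+n∸m≡n (suc r) (q ℕ.* n)))))
            (~-sym (∣∸⇒~ (ℕP.m≤m+n a n) (ℕD.divides 1 (≡.trans (ℕP.m+n∸m≡n a n) (≡.sym (ℕP.*-identityˡ n))))))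
    where
    instance _ = >-nonZero 1≤n
    r = (a ℕ.+ (n ∸ 1)) % n
    q = (a ℕ.+ (n ∸ 1)) / n
    total : a ℕ.+ n ≡ suc r ℕ.+ q ℕ.* n
    total = begin
      a ℕ.+ n                 ≡⟨ cong (a ℕ.+_) (ℕP.m+[n∸m]≡n 1≤n) ⟨
      a ℕ.+ suc (n ∸ 1)       ≡⟨ ℕP.+-suc a (n ∸ 1) ⟩
      suc (a ℕ.+ (n ∸ 1))     ≡⟨ cong suc (m≡m%n+[m/n]*n (a ℕ.+ (n ∸ 1)) n) ⟩
      suc r ℕ.+ q ℕ.* n       ∎
      where open ≡-Reasoning
    r≤ : suc r ≤ a ℕ.+ n
    r≤ = ≡.subst (suc r ≤_) (≡.sym total) (ℕP.m≤m+n (suc r) (q ℕ.* n))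

  Coprime-resp-~ : ∀ {a b} → + a ~ + b → Coprime a n → Coprime b n
  Coprime-resp-~ {a} {b} e coprime {i} (i∣b , i∣n) = coprime
    (∣⇒∣ᵤ (≡.subst (+ i ∣ℤ_) (cancel (+ a) (+ b)) (ℤD.∣m∣n⇒∣m+n (ℤD.∣-trans (∣ᵤ⇒∣ i∣n) (~⇒∣ e)) (∣ᵤ⇒∣ i∣b))) , i∣n)
    where
    cancel : ∀ x y → (x ℤ.- y) ℤ.+ y ≡ x
    cancel = solve-∀

  ~-cancelˡ : ∀ {c x y} → Coprime c n → + c ℤ.* x ~ + c ℤ.* y → x ~ y
  ~-cancelˡ {c} {x} {y} coprime e = ∣⇒~ (∣ᵤ⇒∣ (coprime-divisor (Coprimality.sym coprime)
    (≡.subst (n ∣_) (ℤ.abs-* (+ c) (x ℤ.- y)) (∣⇒∣ᵤ (≡.subst (+ n ∣ℤ_) (factor (+ c) x y) (~⇒∣ e))))))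
    where
    factor : ∀ c x y → c ℤ.* x ℤ.- c ℤ.* y ≡ c ℤ.* (x ℤ.- y)
    factor = solve-∀

Coprime-* : ∀ {a b n} → Coprime a n → Coprime b n → Coprime (a ℕ.* b) n
Coprime-* {a} {b} ca cb {i} (i∣ab , i∣n) =
  cb (coprime-divisor (λ (j∣i , j∣a) → ca (j∣a , ℕD.∣-trans j∣i i∣n)) i∣ab , i∣n)

Coprime-*⁻ˡ : ∀ {a b n} → Coprime (a ℕ.* b) n → Coprime a n
Coprime-*⁻ˡ {b = b} c (i∣a , i∣n) = c (ℕD.∣m⇒∣m*n b i∣a , i∣n)

Coprime-*⁻ʳ : ∀ {a b n} → Coprime (a ℕ.* b) n → Coprime b n
Coprime-*⁻ʳ {a} c (i∣b , i∣n) = c (ℕD.∣n⇒∣m*n a i∣b , i∣n)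

lookup-mono : ∀ {xs} → AllPairs _<_ xs → ∀ {i j} → i Fin.< j → lookup xs i < lookup xs j
lookup-mono {x ∷ xs} (x< ∷ _)     {Fin.zero}  {Fin.suc j} _         = All.lookup x< (∈-lookup {xs = xs} j)
lookup-mono {x ∷ xs} (_ ∷ sorted) {Fin.suc i} {Fin.suc j} (s≤s i<j) = lookup-mono sorted i<j

module _ (𝓐 : ℤ-Algebra) where
  open AlgebraTheory 𝓐

  private
    drop-multiple : ∀ {x n} → x ^ n ≈ 1# → ∀ {k l} → k ≤ l → n ∣ l ∸ k → x ^ l ≈ x ^ k
    drop-multiple {x} xⁿ≈1 {k} k≤l (ℕD.divides q eq) =
      ≈-trans (^-congʳ x (≡.trans (≡.sym (ℕP.m+[n∸m]≡n k≤l)) (cong (k ℕ.+_) eq))) (^-drop-period xⁿ≈1 k q)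

  ^-cong-~ : ∀ {x n} → x ^ n ≈ 1# → ∀ {k l} → Modular._~_ n (+ k) (+ l) → x ^ k ≈ x ^ l
  ^-cong-~ {x} {n} xⁿ≈1 {k} {l} e with ℕP.≤-total k l
  ... | inj₁ k≤l = ≈-sym (drop-multiple xⁿ≈1 k≤l (Congruence.~⇒∣∸ n k≤l e))
  ... | inj₂ l≤k = drop-multiple xⁿ≈1 l≤k (Congruence.~⇒∣∸ n l≤k (Modular.~-sym n e))

module Units (m : ℕ) (1≤m : 1 ≤ m) where
  open Modular m
  open Congruence m

  -- The list whose length defines `φ m`, so that `Fin (φ m)` indexes it directly.
  units : List ℕ
  units = filter (λ a → coprime? a m) (range1 m)

  ∈-units⁺ : ∀ {a} → 1 ≤ a → a ≤ m → Coprime a m → a ∈ units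
  ∈-units⁺ 1≤a a≤m c = ∈-filter⁺ (λ a → coprime? a m) (∈-range1⁺ 1≤a a≤m) c

  ∈-units⁻ : ∀ {a} → a ∈ units → a ∈ range1 m × Coprime a m
  ∈-units⁻ a∈ = ∈-filter⁻ (λ a → coprime? a m) {xs = range1 m} a∈

  unit : Fin (φ m) → ℕ
  unit = lookup units

  unit-bounds : ∀ i → 1 ≤ unit i × unit i ≤ m
  unit-bounds i = ∈-range1⁻ {n = m} (proj₁ (∈-units⁻ (∈-lookup {xs = units} i)))

  unit-coprime : ∀ i → Coprime (unit i) m
  unit-coprime i = proj₂ (∈-units⁻ (∈-lookup {xs = units} i))

  unit-injective : ∀ {i j} → i Fin.< j → ¬ (+ unit i ~ + unit j)
  unit-injective {i} {j} i<j = <⇒≁ (proj₁ (unit-bounds i))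
    (lookup-mono (AllPairs.filter⁺ (λ a → coprime? a m) (range1-sorted m)) i<j)
    (proj₂ (unit-bounds j))

  unit-index : ∀ a → Coprime a m → ∃[ i ] + unit i ~ + a
  unit-index a c = index (representative 1≤m a)
    where
    index : ∃[ b ] 1 ≤ b × b ≤ m × + b ~ + a → ∃[ i ] + unit i ~ + a
    index (b , 1≤b , b≤m , b~a) = Any.index b∈ , ≡.subst (λ u → + u ~ + a) (Any.lookup-index b∈) b~a
      where
      b∈ : b ∈ units
      b∈ = ∈-units⁺ 1≤b b≤m (Coprime-resp-~ (~-sym b~a) c)

-- In the application N is φ m.
module PrimitiveRoot (m g : ℕ) (generator : IsGenerator m g) (N : ℕ) (unit : Fin N → ℕ)
  (unit-coprime   : ∀ i → Coprime (unit i) m)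
  (unit-injective : ∀ {i j} → i Fin.< j → ¬ Modular._~_ m (+ unit i) (+ unit j))
  (unit-index     : ∀ a → Coprime a m → ∃[ i ] Modular._~_ m (+ unit i) (+ a)) where

  open Modular m
  open Congruence m
  open ℤ/m using () renaming (_^_ to _^′_; ^-homo-* to ^′-homo-*; ^-drop-period to ^′-drop-period)

  γ : ℤ
  γ = + g

  1≤N : 1 ≤ N
  1≤N = ℕP.≤-<-trans z≤n (Fin.toℕ<n (proj₁ (unit-index 1 (Coprimality.1-coprimeTo m))))

  coprime-g^ : ∀ k → Coprime (g ℕ.^ k) m
  coprime-g^ zero    = Coprimality.1-coprimeTo m
  coprime-g^ (suc k) = Coprime-* (proj₁ generator) (coprime-g^ k)

  +g^≡ : ∀ k → + (g ℕ.^ k) ≡ γ ^′ k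
  +g^≡ zero    = refl
  +g^≡ (suc k) = ≡.trans (ℤ.pos-* g (g ℕ.^ k)) (cong (γ ℤ.*_) (+g^≡ k))

  log : ∀ a → Coprime a m → ∃[ k ] γ ^′ k ~ + a
  log a c with proj₂ generator a c
  ... | k , m∣ = k , ≡.subst (_~ + a) (+g^≡ k) (∣⇒~ (∣ᵤ⇒∣ m∣))

  power-coprime : ∀ {k a} → γ ^′ k ~ + a → Coprime a m
  power-coprime {k} e = Coprime-resp-~ (≡.subst (_~ _) (≡.sym (+g^≡ k)) e) (coprime-g^ k)

  power-cancel : ∀ {k l} → k ≤ l → γ ^′ k ~ γ ^′ l → γ ^′ (l ∸ k) ~ 1ℤ
  power-cancel {k} {l} k≤l e = ~-sym (~-cancelˡ (coprime-g^ k)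
    (≡.subst₂ _~_ (≡.trans (≡.sym (ℤ.*-identityʳ _)) (cong (ℤ._* 1ℤ) (≡.sym (+g^≡ k)))) refl
      (~-trans e (~-trans (≈⇒~ (cong (γ ^′_) (≡.sym (ℕP.m+[n∸m]≡n k≤l))))
        (~-trans (^′-homo-* γ k (l ∸ k)) (≈⇒~ (cong (ℤ._* γ ^′ (l ∸ k)) (≡.sym (+g^≡ k)))))))))

  -- The N + 1 powers with exponents 0 ... N fall into N unit classes, so two coincide and their
  -- quotient gives a period at most N.
  some-order : ∃[ o ] 1 ≤ o × o ≤ N × γ ^′ o ~ 1ℤ
  some-order with Fin.pigeonhole (ℕP.n<1+n (N)) (λ i → proj₁ (unit-index (g ℕ.^ toℕ i) (coprime-g^ (toℕ i))))
  ... | i , j , i<j , eq = toℕ j ∸ toℕ i , ℕP.m<n⇒0<n∸m i<j ,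
    ℕP.≤-trans (ℕP.m∸n≤m (toℕ j) (toℕ i)) (s≤s⁻¹ (Fin.toℕ<n j)) ,
    power-cancel (ℕP.<⇒≤ i<j) (≡.subst₂ _~_ (+g^≡ (toℕ i)) (+g^≡ (toℕ j))
      (~-trans (~-sym (proj₂ (index i))) (~-trans (≈⇒~ (cong (λ u → + unit u) eq)) (proj₂ (index j)))))
    where
    index : ∀ (i : Fin (suc (N))) → ∃[ u ] + unit u ~ + (g ℕ.^ toℕ i)
    index i = unit-index (g ℕ.^ toℕ i) (coprime-g^ (toℕ i))

  -- If o were below N, the logarithms modulo o of the N distinct units would collide. Together with
  -- `some-order` this pins the order of g to N.
  order-large : ∀ {o} → 1 ≤ o → γ ^′ o ~ 1ℤ → N ≤ o
  order-large {o} 1≤o γ^o~1 = ℕP.≮⇒≥ λ o<N → collision (Fin.pigeonhole o<N reduced-log)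
    where
    instance _ = >-nonZero 1≤o
    unit-log : ∀ i → ∃[ k ] γ ^′ k ~ + unit i
    unit-log i = log (unit i) (unit-coprime i)
    k : Fin (N) → ℕ
    k i = proj₁ (unit-log i)
    reduced-log : Fin (N) → Fin o
    reduced-log i = Fin.fromℕ< (m%n<n (k i) o)
    γ^[k%o]~ : ∀ i → γ ^′ (k i % o) ~ + unit i
    γ^[k%o]~ i = ~-trans (~-sym (^′-drop-period γ^o~1 (k i % o) (k i / o)))
      (~-trans (≈⇒~ (cong (γ ^′_) (≡.sym (m≡m%n+[m/n]*n (k i) o)))) (proj₂ (unit-log i)))
    collision : (∃[ i ] ∃[ j ] i Fin.< j × reduced-log i ≡ reduced-log j) → _
    collision (i , j , i<j , eq) = unit-injective i<j (~-trans (~-sym (γ^[k%o]~ i))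
      (~-trans (≈⇒~ (cong (γ ^′_) (Fin.fromℕ<-injective _ _ (m%n<n (k i) o) (m%n<n (k j) o) eq))) (γ^[k%o]~ j)))

  γ^N~1 : γ ^′ N ~ 1ℤ
  γ^N~1 = ≡.subst (λ n → γ ^′ n ~ 1ℤ) (ℕP.≤-antisym o≤N (order-large 1≤o γ^o~1)) γ^o~1
    where
    1≤o   = proj₁ (proj₂ some-order)
    o≤N   = proj₁ (proj₂ (proj₂ some-order))
    γ^o~1 = proj₂ (proj₂ (proj₂ some-order))

  private
    module Exponent = Modular (N)

    order-divides : ∀ n → γ ^′ n ~ 1ℤ → N ∣ n
    order-divides n e = ℕD.m%n≡0⇒n∣m n (N) (remainder-zero (n % N) (m%n<n n (N)) γ^r~1)
      where
      instance _ = >-nonZero 1≤N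
      γ^r~1 : γ ^′ (n % N) ~ 1ℤ
      γ^r~1 = ~-trans (~-sym (^′-drop-period γ^N~1 (n % N) (n / N)))
        (~-trans (≈⇒~ (cong (γ ^′_) (≡.sym (m≡m%n+[m/n]*n n (N))))) e)
      remainder-zero : ∀ r → r < N → γ ^′ r ~ 1ℤ → r ≡ 0
      remainder-zero zero    _   _ = refl
      remainder-zero (suc r) r<N e = ⊥-elim (ℕP.<⇒≱ r<N (order-large (s≤s z≤n) e))

  -- The discrete logarithm is thereby well defined modulo N.
  equal-powers : ∀ {k l} → γ ^′ k ~ γ ^′ l → + k Exponent.~ + l
  equal-powers {k} {l} e = Sum.[ (λ k≤l → forward k≤l e) , (λ l≤k → Exponent.~-sym (forward l≤k (~-sym e))) ]′ (ℕP.≤-total k l)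
    where
    forward : ∀ {k l} → k ≤ l → γ ^′ k ~ γ ^′ l → + k Exponent.~ + l
    forward {k} {l} k≤l e = Congruence.∣∸⇒~ N k≤l (order-divides (l ∸ k) (power-cancel k≤l e))

  -- The range 1 ... N is the one over which the exponents of the tuples run.
  log-representative : ∀ a → Coprime a m → ∃[ l ] 1 ≤ l × l ≤ N × γ ^′ l ~ + a
  log-representative a c = proj₁ rep , proj₁ (proj₂ rep) , proj₁ (proj₂ (proj₂ rep)) ,
    ~-trans (^-cong-~ quotient γ^N~1 (proj₂ (proj₂ (proj₂ rep)))) (proj₂ (log a c))
    where
    rep = Congruence.representative N 1≤N (proj₁ (log a c))

  module PowerCharacter (𝓐 : ℤ-Algebra) (η : CommutativeRing.Carrier (ℤ-Algebra.commutativeRing 𝓐))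
    (η^N≈1 : CommutativeRing._≈_ (ℤ-Algebra.commutativeRing 𝓐) (AlgebraTheory._^_ 𝓐 η (N)) (AlgebraTheory.1# 𝓐)) where

    open AlgebraTheory 𝓐

    -- The decision is an explicit argument so that later proofs can split on it without abstracting
    -- `coprime? a m` from the goal.
    χ-by : ∀ a → Dec (Coprime a m) → Carrier
    χ-by a (yes c) = η ^ proj₁ (log a c)
    χ-by a (no _)  = 0#

    χ : ℕ → Carrier
    χ a = χ-by a (coprime? a m)

    -- Independence of the chosen logarithm: two exponents for the same residue agree modulo N, and
    -- η^N = 1.
    χ-power : ∀ {a k} → γ ^′ k ~ + a → χ a ≈ η ^ k
    χ-power {a} {k} e = by-cases (coprime? a m)
      where
      by-cases : ∀ c? → χ-by a c? ≈ η ^ k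
      by-cases (yes c) = ^-cong-~ 𝓐 η^N≈1 (equal-powers {proj₁ (log a c)} {k} (~-trans (proj₂ (log a c)) (~-sym e)))
      by-cases (no ¬c) = ⊥-elim (¬c (power-coprime {k} e))

    χ-noncoprime : ∀ {a} → ¬ Coprime a m → χ a ≈ 0#
    χ-noncoprime {a} ¬c = by-cases (coprime? a m)
      where
      by-cases : ∀ c? → χ-by a c? ≈ 0#
      by-cases (yes c) = ⊥-elim (¬c c)
      by-cases (no _)  = ≈-refl

    χ-1 : χ 1 ≈ 1#
    χ-1 = χ-power {1} {0} (≈⇒~ refl)

    χ-cong : ∀ {a b} → + a ~ + b → χ a ≈ χ b
    χ-cong {a} {b} e = by-cases (coprime? a m)
      where
      by-cases : ∀ c? → χ-by a c? ≈ χ b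
      by-cases (yes c) = ≈-sym (χ-power {b} {proj₁ (log a c)} (~-trans (proj₂ (log a c)) e))
      by-cases (no ¬c) = ≈-sym (χ-noncoprime λ c → ¬c (Coprime-resp-~ (~-sym e) c))

    χ-* : ∀ a b → χ (a ℕ.* b) ≈ χ a * χ b
    χ-* a b = by-cases (coprime? a m) (coprime? b m)
      where
      by-cases : ∀ a? b? → χ (a ℕ.* b) ≈ χ-by a a? * χ-by b b?
      by-cases (yes ca) (yes cb) = ≈-trans
        (χ-power {a ℕ.* b} {k ℕ.+ l} (~-trans (^′-homo-* γ k l)
          (~-trans (~-*-cong (proj₂ (log a ca)) (proj₂ (log b cb))) (≈⇒~ (≡.sym (ℤ.pos-* a b))))))
        (^-homo-* η k l)
        where
        k = proj₁ (log a ca)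
        l = proj₁ (log b cb)
      by-cases (yes _)  (no ¬cb) = ≈-trans (χ-noncoprime (λ c → ¬cb (Coprime-*⁻ʳ {a} c))) (≈-sym (zeroʳ _))
      by-cases (no ¬ca) b?       = ≈-trans (χ-noncoprime (λ c → ¬ca (Coprime-*⁻ˡ {a} c))) (≈-sym (zeroˡ _))

-- Divisors of square-free numbers

range1-unique : ∀ n → Unique (range1 n)
range1-unique n = AllPairs.map ℕP.<⇒≢ (range1-sorted n)

prime∤⇒coprime : ∀ {q} → Prime q → ∀ {e} → ¬ (q ∣ e) → Coprime e q
prime∤⇒coprime q-prime q∤e (i∣e , i∣q) with prime⇒irreducible q-prime i∣q
... | inj₁ i≡1  = i≡1
... | inj₂ refl = ⊥-elim (q∤e i∣e)

-- The sublists without `q` come first, then those with it, so a multiplicative sum S becomes S +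
-- χ(q)·S: one Euler factor per prime.
subproducts : List ℕ → List ℕ
subproducts []       = 1 ∷ []
subproducts (q ∷ qs) = subproducts qs ++ map (q ℕ.*_) (subproducts qs)

∈-subproducts⁻ : ∀ qs {e} → e ∈ subproducts qs → e ∣ product qs
∈-subproducts⁻ []       (here refl) = ℕD.∣-refl
∈-subproducts⁻ (q ∷ qs) e∈ with ∈-++⁻ (subproducts qs) e∈
... | inj₁ e∈′ = ℕD.∣n⇒∣m*n q (∈-subproducts⁻ qs e∈′)
... | inj₂ e∈′ with ∈-map⁻ (q ℕ.*_) e∈′
...   | e′ , e′∈ , refl = ℕD.*-monoʳ-∣ q (∈-subproducts⁻ qs e′∈)

∈-subproducts⁺ : ∀ {qs} → All Prime qs → ∀ {e} → e ∣ product qs → e ∈ subproducts qs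
∈-subproducts⁺ {[]}     []              e∣1 = here (ℕD.∣1⇒≡1 e∣1)
∈-subproducts⁺ {q ∷ qs} (q-prime ∷ primes) {e} e∣ with q ∣? e
... | no q∤e = ∈-++⁺ˡ (∈-subproducts⁺ primes (coprime-divisor (prime∤⇒coprime q-prime q∤e) e∣))
... | yes (ℕD.divides k refl) = ∈-++⁺ʳ (subproducts qs)
  (≡.subst (_∈ map (q ℕ.*_) (subproducts qs)) (ℕP.*-comm q k)
    (∈-map⁺ (q ℕ.*_) (∈-subproducts⁺ primes (ℕD.*-cancelˡ-∣ q {{prime⇒nonZero q-prime}} (≡.subst (_∣ q ℕ.* product qs) (ℕP.*-comm k q) e∣)))))

prime∤product : ∀ {q qs} → Prime q → All Prime qs → All (q ≢_) qs → ¬ (q ∣ product qs)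
prime∤product q-prime primes q∉ q∣ = All.lookup q∉ (factorisationHasAllPrimeFactors q-prime q∣ primes) refl

-- The two halves are disjoint: q divides every member of the second and no divisor of the product
-- of the remaining primes.
subproducts-unique : ∀ {qs} → All Prime qs → Unique qs → Unique (subproducts qs)
subproducts-unique []                  []         = [] ∷ []
subproducts-unique {q ∷ qs} (q-prime ∷ primes) (q∉ ∷ unique) = Unique.++⁺ ih
  (Unique.map⁺ (ℕP.*-cancelˡ-≡ _ _ q {{prime⇒nonZero q-prime}}) ih)
  λ (e∈ , qe′∈) → prime∤product q-prime primes q∉ (ℕD.∣-trans (q∣ qe′∈) (∈-subproducts⁻ qs e∈))
  where
  ih = subproducts-unique primes unique
  q∣ : ∀ {e} → e ∈ map (q ℕ.*_) (subproducts qs) → q ∣ e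
  q∣ e∈ with ∈-map⁻ (q ℕ.*_) e∈
  ... | e′ , _ , refl = ℕD.m∣m*n e′

product-∣ : ∀ {qs n} → All Prime qs → Unique qs → All (_∣ n) qs → product qs ∣ n
product-∣ [] [] [] = ℕD.1∣ _
product-∣ {q ∷ qs} (q-prime ∷ primes) (q∉ ∷ unique) (q∣n ∷ qs∣n) with product-∣ primes unique qs∣n
... | ℕD.divides c refl with euclidsLemma c (product qs) q-prime q∣n
...   | inj₁ q∣c = ℕD.*-monoˡ-∣ (product qs) q∣c
...   | inj₂ q∣P = ⊥-elim (prime∤product q-prime primes q∉ q∣P)

∈-primeDivisors⁻ : ∀ {n q} → q ∈ primeDivisors n → Prime q × q ∣ n
∈-primeDivisors⁻ {n} q∈ with ∈-filter⁻ (_∣? n) {xs = filter prime? (range1 n)} q∈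
... | q∈′ , q∣n = proj₂ (∈-filter⁻ prime? {xs = range1 n} q∈′) , q∣n

∈-primeDivisors⁺ : ∀ {n q} → 1 ≤ n → Prime q → q ∣ n → q ∈ primeDivisors n
∈-primeDivisors⁺ {n} {q} 1≤n q-prime q∣n = ∈-filter⁺ (_∣? n)
  (∈-filter⁺ prime? (∈-range1⁺ (ℕ.>-nonZero⁻¹ q {{prime⇒nonZero q-prime}}) (ℕD.∣⇒≤ {{>-nonZero 1≤n}} q∣n)) q-prime) q∣n

primeDivisors-prime : ∀ n → All Prime (primeDivisors n)
primeDivisors-prime n = All.tabulate λ q∈ → proj₁ (∈-primeDivisors⁻ {n} q∈)

primeDivisors-unique : ∀ n → Unique (primeDivisors n)
primeDivisors-unique n = AllPairs.filter⁺ (_∣? n) (AllPairs.filter⁺ prime? (range1-unique n))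

no-prime-divisor⇒≡1 : ∀ n → 1 ≤ n → (∀ {q} → Prime q → ¬ (q ∣ n)) → n ≡ 1
no-prime-divisor⇒≡1 n 1≤n none with factorise n {{>-nonZero 1≤n}}
... | record { factors = [] ; isFactorisation = eq }                              = eq
... | record { factors = q ∷ qs ; isFactorisation = refl ; factorsPrime = q-prime ∷ _ } =
  ⊥-elim (none q-prime (ℕD.m∣m*n (product qs)))

-- With n = c·P, a prime q dividing c also divides n, hence P, so q² would divide n.
product-primeDivisors : ∀ {n} → 1 ≤ n → SquareFree n → n ≡ product (primeDivisors n)
product-primeDivisors {n} 1≤n squareFree
  with product-∣ (primeDivisors-prime n) (primeDivisors-unique n) (All.tabulate λ q∈ → proj₂ (∈-primeDivisors⁻ {n} q∈))
... | ℕD.divides c n≡cP = ≡.trans n≡cP (≡.trans (cong (ℕ._* P) (no-prime-divisor⇒≡1 c 1≤c none)) (ℕP.*-identityˡ P))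
  where
  P = product (primeDivisors n)
  1≤c : 1 ≤ c
  1≤c = ℕP.n≢0⇒n>0 λ { refl → ℕP.<⇒≢ 1≤n (≡.sym n≡cP) }
  none : ∀ {q} → Prime q → ¬ (q ∣ c)
  none {q} q-prime q∣c = ¬prime[1] (≡.subst Prime (squareFree q q²∣n) q-prime)
    where
    q∣n : q ∣ n
    q∣n = ≡.subst (q ∣_) (≡.sym n≡cP) (ℕD.∣m⇒∣m*n P q∣c)
    q²∣n : q ℕ.* q ∣ n
    q²∣n = ≡.subst (q ℕ.* q ∣_) (≡.sym n≡cP) (ℕD.*-pres-∣ q∣c (∈⇒∣product (∈-primeDivisors⁺ 1≤n q-prime q∣n)))

-- The lists are ordered differently, but both are free of duplicates and have the same members.
divisors-↭ : ∀ {n} → 1 ≤ n → SquareFree n → divisors n ↭ subproducts (primeDivisors n)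
divisors-↭ {n} 1≤n squareFree = ∼bag⇒↭ (unique∧set⇒bag
  (AllPairs.filter⁺ (_∣? n) (range1-unique n))
  (subproducts-unique (primeDivisors-prime n) (primeDivisors-unique n))
  (mk⇔ (λ e∈ → ∈-subproducts⁺ (primeDivisors-prime n) (≡.subst (_ ∣_) n≡ (proj₂ (∈-divisors⁻ {n = n} e∈))))
       (λ e∈ → let e∣n = ≡.subst (_ ∣_) (≡.sym n≡) (∈-subproducts⁻ (primeDivisors n) e∈) in
               ∈-divisors⁺ 1≤n (ℕP.n≢0⇒n>0 λ { refl → ℕP.<⇒≢ 1≤n (≡.sym (ℕD.0∣⇒≡0 e∣n)) }) e∣n)))
  where
  n≡ = product-primeDivisors 1≤n squareFree

module _ (𝓐 : ℤ-Algebra) where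
  open AlgebraTheory 𝓐
  open ListSums 𝓐

  multiplicative-sum : ∀ χ → χ 1 ≈ 1# → (∀ a b → χ (a ℕ.* b) ≈ χ a * χ b) → ∀ qs →
                       Σᴸ χ (subproducts qs) ≈ Πᴸ (λ q → 1# + χ q) qs
  multiplicative-sum χ χ-1 χ-* []       = ≈-trans (+-identityʳ _) χ-1
  multiplicative-sum χ χ-1 χ-* (q ∷ qs) = begin
    Σᴸ χ (D ++ map (q ℕ.*_) D)        ≈⟨ Σᴸ-++ χ D (map (q ℕ.*_) D) ⟩
    Σᴸ χ D + Σᴸ χ (map (q ℕ.*_) D)    ≈⟨ +-congˡ (Σᴸ-multiples D) ⟩
    Σᴸ χ D + χ q * Σᴸ χ D             ≈⟨ +-congʳ (*-identityˡ _) ⟨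
    1# * Σᴸ χ D + χ q * Σᴸ χ D        ≈⟨ distribʳ (Σᴸ χ D) 1# (χ q) ⟨
    (1# + χ q) * Σᴸ χ D               ≈⟨ *-congˡ (multiplicative-sum χ χ-1 χ-* qs) ⟩
    (1# + χ q) * Πᴸ (λ q → 1# + χ q) qs ∎
    where
    D = subproducts qs
    Σᴸ-multiples : ∀ es → Σᴸ χ (map (q ℕ.*_) es) ≈ χ q * Σᴸ χ es
    Σᴸ-multiples []       = ≈-sym (zeroʳ _)
    Σᴸ-multiples (e ∷ es) = ≈-trans (+-cong (χ-* q e) (Σᴸ-multiples es)) (≈-sym (distribˡ _ _ _))

open import Data.Nat using (_*_; _^_)

-- The product over tuples

module Characters (𝓐 : ℤ-Algebra) where
  open AlgebraTheory 𝓐 hiding (_*_; _^_)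
  open AlgebraTheory 𝓐 using () renaming (_*_ to _·_; _^_ to _^′_)
  open ListSums 𝓐

  -- The free coefficient c in `local-factor` serves the recursion over coordinates, where it
  -- absorbs the character values of the remaining ones.
  record Character (s g N : ℕ) (η : Carrier) : Set where
    field
      χ            : ℕ → Carrier
      χ-1          : χ 1 ≈ 1#
      χ-*          : ∀ a b → χ (a * b) ≈ χ a · χ b
      χ-cong       : ∀ {a b} → Modular._~_ s (+ a) (+ b) → χ a ≈ χ b
      local-factor : ∀ a c → Πᴸ (λ l → when (a ≡? g ^ l [mod s ]) (1# + c · η ^′ l)) (range1 N) ≈ 1# + c · χ a

  open Character

  character : ∀ {s g η} → 1 ≤ s → IsGenerator s g → η ^′ φ s ≈ 1# → Character s g (φ s) η
  character {s} {g} {η} 1≤s generator η^φ≈1 = record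
    { χ = X.χ ; χ-1 = X.χ-1 ; χ-* = X.χ-* ; χ-cong = X.χ-cong ; local-factor = λ a c → by-cases a c (coprime? a s) }
    where
    open Units s 1≤s using (unit; unit-coprime; unit-injective; unit-index)
    open PrimitiveRoot s g generator (φ s) unit unit-coprime unit-injective unit-index
    module X = PowerCharacter 𝓐 η η^φ≈1
    open Modular s using (_~_; ~-trans; ~-sym; ∣⇒~; ~⇒∣; module ℤ/m)
    P? : ∀ a l → Dec (a ≡ g ^ l [mod s ])
    P? a l = a ≡? g ^ l [mod s ]
    congruent⇒~ : ∀ {a} l → a ≡ g ^ l [mod s ] → γ ℤ/m.^ l ~ + a
    congruent⇒~ l s∣ = ~-sym (≡.subst (+ _ ~_) (+g^≡ l) (∣⇒~ (∣ᵤ⇒∣ s∣)))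
    ~⇒congruent : ∀ {a} l → γ ℤ/m.^ l ~ + a → a ≡ g ^ l [mod s ]
    ~⇒congruent l e = ∣⇒∣ᵤ (~⇒∣ (≡.subst (+ _ ~_) (≡.sym (+g^≡ l)) (~-sym e)))
    by-cases : ∀ a c → Dec (Coprime a s) →
      Πᴸ (λ l → when (P? a l) (1# + c · η ^′ l)) (range1 (φ s)) ≈ 1# + c · X.χ a
    -- No power of g is congruent to `a`, so every factor is 1, in agreement with χ(a) = 0.
    by-cases a c (no ¬coprime) = ≈-trans
      (Πᴸ-when-no (P? a) (λ l → 1# + c · η ^′ l) {range1 (φ s)} (All.tabulate λ {l} _ s∣ → ¬coprime (power-coprime {l} (congruent⇒~ l s∣))))
      (≈-sym (≈-trans (+-congˡ (≈-trans (*-congˡ (X.χ-noncoprime ¬coprime)) (zeroʳ c))) (+-identityʳ 1#)))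
    -- Exactly one l in 1 ... φ(s) is a logarithm of `a`, and its factor alone remains.
    by-cases a c (yes coprime) = ≈-trans
      (Πᴸ-when-unique (P? a) (λ l → 1# + c · η ^′ l) (range1-unique (φ s)) (∈-range1⁺ 1≤l l≤φ) (~⇒congruent l γ^l~a)
        λ {k} k∈ s∣ → Congruence.representative-unique (φ s) (proj₁ (∈-range1⁻ k∈)) (proj₂ (∈-range1⁻ k∈)) 1≤l l≤φ
          (equal-powers {k} {l} (~-trans (congruent⇒~ k s∣) (~-sym γ^l~a))))
      (+-congˡ (*-congˡ (≈-sym (X.χ-power {a} {l} γ^l~a))))
      where
      l     = proj₁ (log-representative a coprime)
      1≤l   = proj₁ (proj₂ (log-representative a coprime))
      l≤φ   = proj₁ (proj₂ (proj₂ (log-representative a coprime)))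
      γ^l~a = proj₂ (proj₂ (proj₂ (log-representative a coprime)))

  monomial : ∀ r → (Fin r → Carrier) → (Fin r → ℕ) → Carrier
  monomial zero    η L = 1#
  monomial (suc r) η L = η Fin.zero ^′ L Fin.zero · monomial r (η ∘ Fin.suc) (L ∘ Fin.suc)

  productChar : ∀ r → (Fin r → ℕ → Carrier) → ℕ → Carrier
  productChar zero    χs a = 1#
  productChar (suc r) χs a = χs Fin.zero a · productChar r (χs ∘ Fin.suc) a

  productChar-1 : ∀ r {χs} → (∀ i → χs i 1 ≈ 1#) → productChar r χs 1 ≈ 1#
  productChar-1 zero    _    = ≈-refl
  productChar-1 (suc r) χs-1 = ≈-trans (*-cong (χs-1 Fin.zero) (productChar-1 r (χs-1 ∘ Fin.suc))) (*-identityˡ 1#)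

  productChar-* : ∀ r {χs} → (∀ i a b → χs i (a * b) ≈ χs i a · χs i b) →
                  ∀ a b → productChar r χs (a * b) ≈ productChar r χs a · productChar r χs b
  productChar-* zero    _         a b = ≈-sym (*-identityˡ 1#)
  productChar-* (suc r) {χs} χs-* a b = ≈-trans (*-cong (χs-* Fin.zero a b) (productChar-* r (χs-* ∘ Fin.suc) a b))
    (solve 4 (λ x y u v → (x :* y) :* (u :* v) := (x :* u) :* (y :* v)) ≈-refl _ _ _ _)

  productChar-cong : ∀ r {χs a b} → (∀ i → χs i a ≈ χs i b) → productChar r χs a ≈ productChar r χs b
  productChar-cong zero    _ = ≈-refl
  productChar-cong (suc r) e = *-cong (e Fin.zero) (productChar-cong r (e ∘ Fin.suc))

  matches? : ∀ {r} (s g L : Fin r → ℕ) a → Dec (∀ j → a ≡ g j ^ L j [mod s j ])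
  matches? s g L a = all? (λ j → a ≡? g j ^ L j [mod s j ])

  -- At most one tuple L matches a, so all but one factor is 1.
  tuples-product : ∀ r {s g N η} (chars : ∀ i → Character (s i) (g i) (N i) (η i)) a c →
    Πᴸ (λ L → when (matches? s g L a) (1# + c · monomial r η L)) (tuples r N)
      ≈ 1# + c · productChar r (χ ∘ chars) a
  tuples-product zero {s} {g} {N} {η} chars a c = ≈-trans (*-identityʳ _) (when-yes (matches? s g (λ ()) a) λ ())
  tuples-product (suc r) {s} {g} {N} {η} chars a c = begin
    Πᴸ F (tuples (suc r) N)
      ≈⟨ Πᴸ-concatMap F (λ l → map (l VF.∷_) Ls) (range1 (N 0F)) ⟩
    Πᴸ (λ l → Πᴸ F (map (l VF.∷_) Ls)) (range1 (N 0F))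
      ≈⟨ Πᴸ-cong (λ l → ≈-trans (Πᴸ-map F (l VF.∷_) Ls) (inner l)) (range1 (N 0F)) ⟩
    Πᴸ (λ l → when (P₀? l) (1# + c · χ′ · η 0F ^′ l)) (range1 (N 0F))
      ≈⟨ local-factor (chars 0F) a (c · χ′) ⟩
    1# + c · χ′ · χ (chars 0F) a
      ≈⟨ +-congˡ (solve 3 (λ c x y → c :* x :* y := c :* (y :* x)) ≈-refl c χ′ (χ (chars 0F) a)) ⟩
    1# + c · (χ (chars 0F) a · χ′) ∎
    where
    0F = Fin.zero
    Ls = tuples r (N ∘ Fin.suc)
    χ′ = productChar r (χ ∘ chars ∘ Fin.suc) a
    F : (Fin (suc r) → ℕ) → Carrier
    F L = when (matches? s g L a) (1# + c · monomial (suc r) η L)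
    P₀? : ∀ l → Dec (a ≡ g 0F ^ l [mod s 0F ])
    P₀? l = a ≡? g 0F ^ l [mod s 0F ]
    G : ℕ → (Fin r → ℕ) → Carrier
    G l L = when (matches? (s ∘ Fin.suc) (g ∘ Fin.suc) L a) (1# + c · (η 0F ^′ l · monomial r (η ∘ Fin.suc) L))
    split : ∀ l L → F (l VF.∷ L) ≈ when (P₀? l) (G l L)
    split l L = when-× (P₀? l) (matches? (s ∘ Fin.suc) (g ∘ Fin.suc) L a) (matches? s g (l VF.∷ L) a)
      (λ all → all Fin.zero , all ∘ Fin.suc) λ { first rest Fin.zero → first ; first rest (Fin.suc j) → rest j }
    -- If the first coordinate does not match, all factors are 1; if it does, η₀^l joins the
    -- coefficient c and the induction hypothesis applies.
    factor-out : ∀ l (p? : Dec (a ≡ g 0F ^ l [mod s 0F ])) →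
      Πᴸ (λ L → when p? (G l L)) Ls ≈ when p? (1# + c · χ′ · η 0F ^′ l)
    factor-out l (no _)  = Πᴸ-1 Ls
    factor-out l (yes _) = begin
      Πᴸ (G l) Ls
        ≈⟨ Πᴸ-cong (λ L → when-cong (matches? (s ∘ Fin.suc) (g ∘ Fin.suc) L a) (+-congˡ (≈-sym (*-assoc c _ _)))) Ls ⟩
      Πᴸ (λ L → when (matches? (s ∘ Fin.suc) (g ∘ Fin.suc) L a) (1# + c · η 0F ^′ l · monomial r (η ∘ Fin.suc) L)) Ls
        ≈⟨ tuples-product r (chars ∘ Fin.suc) a (c · η 0F ^′ l) ⟩
      1# + c · η 0F ^′ l · χ′
        ≈⟨ +-congˡ (solve 3 (λ c x y → c :* x :* y := c :* y :* x) ≈-refl c (η 0F ^′ l) χ′) ⟩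
      1# + c · χ′ · η 0F ^′ l ∎
    inner : ∀ l → Πᴸ (λ L → F (l VF.∷ L)) Ls ≈ when (P₀? l) (1# + c · χ′ · η 0F ^′ l)
    inner l = ≈-trans (Πᴸ-cong (split l) Ls) (factor-out l (P₀? l))

  Πᴸ-when-count : ∀ {A : Set} {P : A → Set} (P? : ∀ x → Dec (P x)) v xs →
                  v ^′ length (filter P? xs) ≈ Πᴸ (λ x → when (P? x) v) xs
  Πᴸ-when-count P? v []       = ≈-refl
  Πᴸ-when-count P? v (x ∷ xs) with P? x
  ... | yes _ = *-congˡ (Πᴸ-when-count P? v xs)
  ... | no _  = ≈-trans (Πᴸ-when-count P? v xs) (≈-sym (*-identityˡ _))

  module _ (n p : ℕ) (almostPrime : AlmostPrime n) (p-prime : Prime p) (p∣n : p ∣ n)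
    (p≈0 : ι (+ p) ≈ 0#)
    (r : ℕ) (s g : Fin r → ℕ) (η : Fin r → Carrier)
    (s∣p∸1 : ∀ i → s i ∣ p ∸ 1) (chars : ∀ i → Character (s i) (g i) (φ (s i)) (η i)) where

    χ̄ : ℕ → Carrier
    χ̄ = productChar r (χ ∘ chars)

    open ReducedExponents p p-prime
    open LinearExtension 𝓐 p≈0

    χ̄-periodic : ∀ e → 1 ≤ e → χ̄ (reduce e) ≈ χ̄ e
    χ̄-periodic (suc e) _ = productChar-cong r λ i → χ-cong (chars i) (Congruence.∣∸⇒~ (s i)
      (s≤s (≡.subst (e % (p ∸ 1) ≤_) (≡.sym e≡) (ℕP.m≤m+n (e % (p ∸ 1)) _)))
      (ℕD.∣-trans (s∣p∸1 i) (ℕD.divides (e / (p ∸ 1))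
        (≡.trans (cong (_∸ e % (p ∸ 1)) e≡) (ℕP.m+n∸m≡n (e % (p ∸ 1)) _)))))
      where
      e≡ = m≡m%n+[m/n]*n e (p ∸ 1)

    f-value : Πᴸ (λ L → (1# + monomial r η L) ^′ ω n r s g L) (tuples r (φ ∘ s)) ≈ ι (+ d n)
    f-value = begin
      Πᴸ (λ L → (1# + monomial r η L) ^′ ω n r s g L) Ls
        ≈⟨ Πᴸ-cong (λ L → Πᴸ-when-count (matches? s g L) (1# + monomial r η L) ps) Ls ⟩
      Πᴸ (λ L → Πᴸ (λ a → when (matches? s g L a) (1# + monomial r η L)) ps) Ls
        ≈⟨ Πᴸ-swap (λ L a → when (matches? s g L a) (1# + monomial r η L)) Ls ps ⟩
      Πᴸ (λ a → Πᴸ (λ L → when (matches? s g L a) (1# + monomial r η L)) Ls) ps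
        ≈⟨ Πᴸ-cong euler-factor ps ⟩
      Πᴸ (λ a → 1# + χ̄ a) ps
        ≈⟨ multiplicative-sum 𝓐 χ̄ χ̄-1 (productChar-* r (λ i → χ-* (chars i))) ps ⟨
      Σᴸ χ̄ (subproducts ps)
        ≈⟨ Σᴸ-↭ χ̄ (divisors-↭ (proj₁ (proj₁ almostPrime)) (proj₂ almostPrime)) ⟨
      Σᴸ χ̄ (divisors n)
        ≈⟨ periodic-divisor-sum (proj₁ almostPrime) p∣n χ̄ χ̄-periodic ⟩
      ι (+ d n) · χ̄ 1
        ≈⟨ ≈-trans (*-congˡ χ̄-1) (*-identityʳ _) ⟩
      ι (+ d n) ∎
      where
      Ls = tuples r (φ ∘ s)
      ps = primeDivisors n
      χ̄-1 = productChar-1 r (λ i → χ-1 (chars i))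
      euler-factor : ∀ a → Πᴸ (λ L → when (matches? s g L a) (1# + monomial r η L)) Ls ≈ 1# + χ̄ a
      euler-factor a = begin
        Πᴸ (λ L → when (matches? s g L a) (1# + monomial r η L)) Ls
          ≈⟨ Πᴸ-cong (λ L → when-cong (matches? s g L a) (+-congˡ (*-identityˡ _))) Ls ⟨
        Πᴸ (λ L → when (matches? s g L a) (1# + 1# · monomial r η L)) Ls
          ≈⟨ tuples-product r chars a 1# ⟩
        1# + 1# · χ̄ a
          ≈⟨ +-congˡ (*-identityˡ _) ⟩
        1# + χ̄ a ∎

-- Specialisation to powers of ζ in ℤ[X]/(p, Φ_m)

factor-∣-∏ : ∀ r (s : Fin r → ℕ) i → s i ∣ ∏ r s
factor-∣-∏ (suc r) s Fin.zero    = ℕD.m∣m*n (∏ r (s ∘ Fin.suc))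
factor-∣-∏ (suc r) s (Fin.suc i) = ℕD.∣n⇒∣m*n (s Fin.zero) (factor-∣-∏ r (s ∘ Fin.suc) i)

∣-positive : ∀ {a b} → 1 ≤ b → a ∣ b → 1 ≤ a
∣-positive 1≤b a∣b = ℕP.n≢0⇒n>0 λ { refl → ℕP.<⇒≢ 1≤b (≡.sym (ℕD.0∣⇒≡0 a∣b)) }

φ-positive : ∀ m → 1 ≤ m → 1 ≤ φ m
φ-positive m 1≤m = ℕP.≤-<-trans z≤n (Fin.toℕ<n (proj₁ (Units.unit-index m 1≤m 1 (Coprimality.1-coprimeTo m))))

module CyclotomicIntegers (m p : ℕ) (1≤m : 1 ≤ m) where
  open Quotient polyAlgebra (const (+ p)) (Φ m)
  open AlgebraTheory quotient hiding (_*_; _^_)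
  open AlgebraTheory quotient using () renaming (_*_ to _·_; _^_ to _^′_)
  open ListSums quotient using (Πᴸ; Πᴸ-cong)
  open Characters quotient using (monomial)

  p~0 : const (+ p) ~ 0#
  p~0 = ≈-trans (≈-sym (*-identityʳ (const (+ p)))) (generator₁~0 (const 1ℤ))

  X^-~ : ∀ k l → X^ k ^′ l ~ X^ (k * l)
  X^-~ k l = ≈⇒~ (≡.subst (_≈ₚ X^ (k * l)) (^-quotient (X^ k) l) (X^-^ k l))

  ζ^m~1 : X^ m ~ 1#
  ζ^m~1 = x-1≈0⇒x≈1 (≈-trans (≈⇒~ (Cyclotomic.unity-product (cyclotomic m 1≤m))) (generator₂~0 (Φ-proper m)))

  ζ^-multiple : ∀ {k} → m ∣ k → X^ k ~ 1#
  ζ^-multiple (ℕD.divides q refl) = ≈-trans (≈-sym (≡.subst (λ n → X^ m ^′ q ~ X^ n) (ℕP.*-comm m q) (X^-~ m q)))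
    (≈-trans (^-congˡ q ζ^m~1) (1^n≈1 q))

  monomial-ζ : ∀ r (e L : Fin r → ℕ) → X^ (∑ r (λ i → L i * e i)) ~ monomial r (λ i → X^ (e i)) L
  monomial-ζ zero    e L = ≈-refl
  monomial-ζ (suc r) e L = ≈-trans (≈⇒~ (X^-homo-+ (L Fin.zero * e Fin.zero) _)) (*-cong
    (≈-sym (≡.subst (λ n → X^ (e Fin.zero) ^′ L Fin.zero ~ X^ n) (ℕP.*-comm (e Fin.zero) (L Fin.zero)) (X^-~ (e Fin.zero) (L Fin.zero))))
    (monomial-ζ r (e ∘ Fin.suc) (L ∘ Fin.suc)))

  ^ₚ-~ : ∀ {P Q} → P ~ Q → ∀ k → P ^ₚ k ~ Q ^′ k
  ^ₚ-~ e zero    = ≈-refl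
  ^ₚ-~ e (suc k) = *-cong e (^ₚ-~ e k)

  ∏ₚ-~ : ∀ {A : Set} {F : A → Poly} {G} → (∀ x → F x ~ G x) → ∀ xs → ∏ₚ (map F xs) ~ Πᴸ G xs
  ∏ₚ-~ F~G []       = ≈-refl
  ∏ₚ-~ F~G (x ∷ xs) = *-cong (F~G x) (∏ₚ-~ F~G xs)

  fAtζ-~ : ∀ n r s g e → fAtζ n r s g e ~
    Πᴸ (λ L → (1# + monomial r (λ i → X^ (e i)) L) ^′ ω n r s g L) (tuples r (φ ∘ s))
  fAtζ-~ n r s g e = ∏ₚ-~ (λ L → ^ₚ-~ (+-congˡ {const 1ℤ} (monomial-ζ r e L)) (ω n r s g L)) (tuples r (φ ∘ s))

  ~⇒CongZζ : ∀ {P Q} → P ~ Q → CongZζ m p P Q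
  ~⇒CongZζ (modulo A B eq) = A , B , λ i → _≈ₚ_.at (≈ₚ-trans eq (+ₚ-cong (const-*ₚ (+ p) A) (≈ₚ-refl {Φ m *ₚ B}))) i

theorem1p12 : (n : ℕ) → AlmostPrime n →
    (p : ℕ) → Prime p → p ∣ n →
    (r : ℕ) (q ν : Fin r → ℕ) →
    (∀ i → Prime (q i)) → (∀ i → ¬ (2 ∣ q i)) → (∀ i j → q i ≡ q j → i ≡ j) →
    (∀ i → 1 ≤ ν i) →
    ∏ r (λ i → q i ^ ν i) ∣ p ∸ 1 →
    (g : Fin r → ℕ) → (∀ i → IsGenerator (q i ^ ν i) (g i)) →
    (e : Fin r → ℕ) → (∀ i → φ (∏ r (λ j → q j ^ ν j)) ∣ e i * φ (q i ^ ν i)) →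
    CongZζ (φ (∏ r (λ j → q j ^ ν j))) p
           (fAtζ n r (λ i → q i ^ ν i) g e)
           (const (+ d n))
theorem1p12 n almostPrime p p-prime p∣n r q ν _ _ _ _ ∏∣p∸1 g generator e m∣ =
  ~⇒CongZζ (AlgebraTheory.≈-trans quotient (fAtζ-~ n r s g e)
    (f-value n p almostPrime p-prime p∣n p~0 r s g (λ i → X^ (e i)) s∣p∸1
      λ i → character (∣-positive 1≤p∸1 (s∣p∸1 i)) (generator i)
        -- With ηᵢ = ζ^(eᵢ), the power ηᵢ^φ(sᵢ) is ζ^(eᵢ·φ(sᵢ)), which is 1 because φ(s) divides the
        -- exponent.
        (AlgebraTheory.≈-trans quotient (X^-~ (e i) (φ (s i))) (ζ^-multiple (m∣ i)))))
  where
  s : Fin r → ℕ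
  s i = q i ^ ν i
  -- Positivity of p - 1 passes to its divisors: to each sᵢ for `character`, and to s, so that m =
  -- φ(s) is at least 1.
  1≤p∸1 : 1 ≤ p ∸ 1
  1≤p∸1 = ℕP.m<n⇒0<n∸m (ℕ.nonTrivial⇒n>1 p {{prime⇒nonTrivial p-prime}})
  s∣p∸1 : ∀ i → s i ∣ p ∸ 1
  s∣p∸1 i = ℕD.∣-trans (factor-∣-∏ r s i) ∏∣p∸1
  m = φ (∏ r s)
  open CyclotomicIntegers m p (φ-positive (∏ r s) (∣-positive 1≤p∸1 ∏∣p∸1))
  open Quotient polyAlgebra (const (+ p)) (Φ m) using (quotient)
  open Characters quotient using (character; f-value)
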